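{- Let $$z=\sum_{1\le i<j<k<l\le n}\xi_{ijkl},$$ where $\xi_{ijkl}\in H_{ijkl}$ are arbitrary elements, that is, $\xi_{ijkl}=w_{ijkl}\,\eta_{ijkl}+w_{iklj}\,\eta_{iklj}$ for some $w_{ijkl},w_{iklj}\in\mathbb{C}$. Let $\chi_z^{\mathbb{C}^n}(t)=\det(t\,\mathrm{Id}-z)$ be the characteristic polynomial of $z$ acting in the permutation representation $\mathbb{C}^n$ of $S_n$. Then $$\chi_z^{\mathbb{C}^n}(t)=t^n+\mu_1t^{n-1}+\dots+\mu_{n-1}t,$$ where $$\mu_r=\Phi_r(z^{\otimes r})$$ for every $r=1,\dots,n-1$.
   Context: The permutation group $S_n$ acts on $\mathbb{C}^n$ by permuting coordinates, and the action is extended linearly to the group algebra $\mathbb{C}[S_n]$. The notation $(i_1\dots i_k)$ means the cyclic permutation $i_1\mapsto i_2\mapsto\dots\mapsto i_k\mapsto i_1$ leaving all other elements fixed. For pairwise distinct $i,j,k,l\in\{1,\dots,n\}$ put $\eta_{ijkl}=(ijkl)+(ilkj)-(ijlk)-(iklj)\in\mathbb{C}[S_n]$. For $1\le i<j<k<l\le n$, $H_{ijkl}\subset\mathbb{C}[S_n]$ is the vector space spanned by all $\eta_{pqrs}$ with $(p,q,r,s)$ a permutation of $(i,j,k,l)$; it has dimension 2 and basis $\{\eta_{ijkl},\eta_{iklj}\}$. Shuffle determinant: for $n\times n$ matrices $A=(a_{ij})$, $B=(b_{ij})$ (of any size $n$) and $I\subseteq\{1,\dots,n\}$, the $I$-shuffle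 is the $n\times n$ matrix $(A,B)_I=(u_{ij})$ with $u_{ij}=a_{ij}$ if $i\in I$ and $u_{ij}=b_{ij}$ if $i\notin I$. The shuffle determinant is $$\mathrm{sdet}(A,B)=\sum_{I\subseteq\{1,\dots,n\}}\det(A,B)_I\,\det(A,B)_{\bar I},\qquad \bar I=\{1,\dots,n\}\setminus I.$$ The functional $\Phi_r$: let $\mathcal{E}$ be an $r$-element set whose elements are 4-tuples $(i_1,j_1,k_1,l_1),\dots,(i_r,j_r,k_r,l_r)$; here $1\le r\le n$. Let $H_{\mathcal E}=\bigotimes_{s=1}^r H_{i_sj_sk_sl_s}$, a vector space of dimension $2^r$. Let $A_{\mathcal E},B_{\mathcal E}$ be the $r\times n$ matrices with $(A_{\mathcal E})_{s i_s}=1$, $(A_{\mathcal E})_{s j_s}=-1$, $(B_{\mathcal E})_{s k_s}=1$, $(B_{\mathcal E})_{s l_s}=-1$ for $s=1,\dots,r$, and all other entries $0$. For an $r$-element set $J\subseteq\{1,\dots,n\}$ let $A_{\mathcal E}^J,B_{\mathcal E}^J$ be the $r\times r$ submatrices of $A_{\mathcal E},B_{\mathcal E}$ containing all $r$ rows and the columns listed in $J$. The linear functional $\Phi_r:H_{\mathcal E}\to\mathbb{C}$ is defined by $$\Phi_r(\eta_{i_1j_1k_1l_1}\otimes\dots\otimes\eta_{i_rj_rk_rl_r})=\sum_{J\subseteq\{1,\dots,n\},\ \#J=r}\mathrm{sdet}(A_{\mathcal E}^J,B_{\mathcal E}^J)$$ and extended to the whole of $H_{\mathcal E}$ by linearity.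 In $\Phi_r(z^{\otimes r})$ the tensor power $z^{\otimes r}$ is expanded by linearity into tensor products of elements of the spaces $H_{ijkl}$, and $\Phi_r$ is applied term by term.
   Formalization: The formula is proved as r!·μ_r = Φ_r(z^{⊗r}) (over any field of characteristic zero); as printed, without r!, it fails: for n=4, r=2, z=η_{1234}, the characteristic polynomial is t^4−4t^2, so μ_2=−4, while Φ_2(z⊗z)=−8. -}

module Defs where

open import Algebra.Bundles using (CommutativeRing; Semiring)
open import Algebra.Apartness.Bundles using (HeytingField; HeytingCommutativeRing)
import Algebra.Definitions.RawSemiring as RawSemiringDefinitions
open import Data.Bool.Base using (if_then_else_)
open import Data.Fin.Base using (Fin; zero; suc; toℕ; punchIn)
open import Data.Fin.Permutation using (Permutation′; transpose; _∘ₚ_; _⟨$⟩ˡ_)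
open import Data.Fin.Properties using (_≟_)
open import Data.Fin.Subset using (Subset; inside; outside; ∁)
open import Data.List.Base as List using (List; []; _∷_; _++_; concatMap; cartesianProductWith)
open import Data.Nat.Base using (ℕ; zero; suc)
open import Data.Product.Base using (_×_; _,_)
open import Data.Vec.Base as Vec using (Vec; []; _∷_; lookup)
open import Data.Vec.Functional using (Vector)
open import Relation.Nullary.Decidable using (does)

-- The r-element subsets of {0,…,n-1}, each listed in increasing order.
increasing : ∀ r n → List (Vec (Fin n) r)
increasing zero    n       = [] ∷ []
increasing (suc r) zero    = []
increasing (suc r) (suc n) =
  List.map (λ J → zero ∷ Vec.map suc J) (increasing r n) ++
  List.map (Vec.map suc) (increasing (suc r) n)

subsets : ∀ n → List (Subset n)
subsets zero    = [] ∷ []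
subsets (suc n) = List.map (outside ∷_) (subsets n) ++ List.map (inside ∷_) (subsets n)

-- The cycle i ↦ j ↦ k ↦ l ↦ i, for pairwise distinct i, j, k, l; the
-- leftmost factor of _∘ₚ_ acts first.
cycle : ∀ {n} → Fin n → Fin n → Fin n → Fin n → Permutation′ n
cycle i j k l = transpose i j ∘ₚ transpose i k ∘ₚ transpose i l

Quad : ℕ → Set
Quad n = Vec (Fin n) 4

module LieElement {c ℓ} (K : CommutativeRing c ℓ) where

  open CommutativeRing K public using (Carrier; _≈_; _+_; _*_; -_; _-_; 0#; 1#)
  open RawSemiringDefinitions (Semiring.rawSemiring (CommutativeRing.semiring K)) public
    using (_^_; sum) renaming (_×_ to infixr 8 _·_)

  sumOver : ∀ {a} {X : Set a} → List X → (X → Carrier) → Carrier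
  sumOver xs f = List.foldr (λ x s → f x + s) 0# xs

  -- Formal linear combinations of elements of X.
  Lin : Set → Set c
  Lin X = List (Carrier × X)

  extendLinearly : ∀ {X} → (X → Carrier) → Lin X → Carrier
  extendLinearly f x = sumOver x λ (a , e) → a * f e

  scale : ∀ {X} → Carrier → Lin X → Lin X
  scale a = List.map λ (b , e) → a * b , e

  -- The pure tensor e₁ ⊗ … ⊗ eᵣ is the vector e₁ ∷ … ∷ eᵣ ∷ [].
  infixl 8 _⊗^_
  _⊗^_ : ∀ {X} → Lin X → (r : ℕ) → Lin (Vec X r)
  x ⊗^ zero  = (1# , []) ∷ []
  x ⊗^ suc r = cartesianProductWith (λ (a , e) (b , es) → a * b , e ∷ es) x (x ⊗^ r)

  Matrix : ℕ → ℕ → Set c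
  Matrix m n = Fin m → Fin n → Carrier

  -- Laplace expansion along the first row.
  det : ∀ {n} → Matrix n n → Carrier
  det {zero}  A = 1#
  det {suc n} A = sum λ j →
    (- 1#) ^ toℕ j * (A zero j * det λ p q → A (suc p) (punchIn j q))

  GroupAlgebra : ℕ → Set c
  GroupAlgebra n = Lin (Permutation′ n)

  -- σ maps the basis vector e_q to e_{σ q}.
  act : ∀ {n} → GroupAlgebra n → Vector Carrier n → Vector Carrier n
  act x v p = extendLinearly (λ σ → v (σ ⟨$⟩ˡ p)) x

  basis : ∀ {n} → Fin n → Vector Carrier n
  basis q p = if does (p ≟ q) then 1# else 0#

  matrixOf : ∀ {n} → (Vector Carrier n → Vector Carrier n) → Matrix n n
  matrixOf f p q = f (basis q) p

  χ : ∀ {n} → GroupAlgebra n → Carrier → Carrier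
  χ x t = det (matrixOf λ v p → t * v p - act x v p)

  η : ∀ {n} → Quad n → GroupAlgebra n
  η (i ∷ j ∷ k ∷ l ∷ []) =
    (1#   , cycle i j k l) ∷ (1#   , cycle i l k j) ∷
    (- 1# , cycle i j l k) ∷ (- 1# , cycle i k l j) ∷ []

  -- A combination of quadruples stands for the same combination of the η's.
  -- Elements of ⊕ H_{ijkl} are given by their coordinates with respect to the
  -- basis η_{ijkl}, η_{iklj} (i < j < k < l).
  ⟦_⟧ : ∀ {n} → Lin (Quad n) → GroupAlgebra n
  ⟦ x ⟧ = concatMap (λ (a , q) → scale a (η q)) x

  module _ {n} (w : Fin n → Fin n → Fin n → Fin n → Carrier) where

    ξ : Quad n → Lin (Quad n)
    ξ (i ∷ j ∷ k ∷ l ∷ []) =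
      (w i j k l , i ∷ j ∷ k ∷ l ∷ []) ∷ (w i k l j , i ∷ k ∷ l ∷ j ∷ []) ∷ []

    z : Lin (Quad n)
    z = concatMap ξ (increasing 4 n)

  shuffle : ∀ {m n} → Matrix m n → Matrix m n → Subset m → Matrix m n
  shuffle A B I i = if lookup I i then A i else B i

  sdet : ∀ {n} → Matrix n n → Matrix n n → Carrier
  sdet {n} A B = sumOver (subsets n) λ I → det (shuffle A B I) * det (shuffle A B (∁ I))

  differenceRow : ∀ {n} → Fin n → Fin n → Vector Carrier n
  differenceRow x y p =
    if does (p ≟ x) then 1# else if does (p ≟ y) then - 1# else 0#

  rowA rowB : ∀ {n} → Quad n → Vector Carrier n
  rowA (i ∷ j ∷ k ∷ l ∷ []) = differenceRow i j
  rowB (i ∷ j ∷ k ∷ l ∷ []) = differenceRow k l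

  A[_] B[_] : ∀ {n r} → Vec (Quad n) r → Matrix r n
  A[ E ] s = rowA (lookup E s)
  B[ E ] s = rowB (lookup E s)

  columns : ∀ {m n r} → Matrix m n → Vec (Fin n) r → Matrix m r
  columns M J s p = M s (lookup J p)

  -- A family E of r quadruples is a sequence, possibly with repetitions: the
  -- expansion of a tensor power contains the terms η_q ⊗ η_q, and it contains
  -- all orderings of a family separately.  Hence a coefficient of the
  -- characteristic polynomial has to be compared with Φ of the tensor power
  -- divided by r!.  For n = 4, r = 2 and z = η₁₂₃₄, χ = t⁴ - 4t² whereas
  -- Φ (z ⊗ z) = -8.
  Φ : ∀ {n r} → Lin (Vec (Quad n) r) → Carrier
  Φ {n} {r} = extendLinearly λ E →
    sumOver (increasing r n) λ J → sdet (columns A[ E ] J) (columns B[ E ] J)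

module _ {c ℓ₁ ℓ₂} (F : HeytingField c ℓ₁ ℓ₂) where

  fieldRing : CommutativeRing c ℓ₁
  fieldRing = HeytingCommutativeRing.commutativeRing (HeytingField.heytingCommutativeRing F)

  CharacteristicZero : Set ℓ₂
  CharacteristicZero = ∀ m → (suc m · 1#) # 0#
    where
    open HeytingField F using (_#_)
    open LieElement fieldRing using (_·_; 1#; 0#)

{-# OPTIONS --safe #-}

-- η_{ijkl} acts on ℂⁿ as -(a bᵀ + b aᵀ) with a = e_i - e_j and b = e_k - e_l, so
-- t - z = t + N, where N is a linear combination of rank one matrices.  The
-- coefficient of t^{n-r} in det (t + N) is the sum of the principal minors of N of
-- size r, and expanding each of them by the Cauchy-Binet formula over all
-- sequences of r rank one summands, rather than all r-element sets (whence the
-- factor r!), gives the shuffle determinants.  The constant coefficient det N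
-- vanishes since the columns of N sum to zero.

module Submission where

open import Defs
open import Algebra.Apartness.Bundles using (HeytingField)
open import Algebra.Bundles using (CommutativeRing)
open import Data.Bool.Base using (Bool; true; false; if_then_else_; not)
open import Data.Fin.Base using (Fin; zero; suc; toℕ; punchIn; inject₁; fromℕ)
open import Data.Fin.Permutation using (_⟨$⟩ˡ_)
open import Data.Fin.Permutation.Components using (transpose)
open import Data.Fin.Properties using (_≟_; suc-injective; toℕ-inject₁; toℕ-fromℕ)
open import Data.Fin.Subset using (inside; outside)
open import Data.List.Base as List using (List; []; _∷_; _++_; concatMap; cartesianProductWith)
open import Data.List.Relation.Unary.All as ListAll using ([]; _∷_)
import Data.List.Relation.Unary.All.Properties as ListAll
open import Data.Nat.Base as ℕ using (ℕ; zero; suc; _∸_; _≤_; _<_; _!)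
import Data.Nat.Properties as ℕ
open import Data.Product.Base using (_×_; _,_; proj₂; Σ-syntax)
open import Data.Sum.Base using (_⊎_; inj₁; inj₂)
open import Data.Sum.Properties using (inj₁-injective)
open import Data.Vec.Base as Vec using (Vec; []; _∷_; lookup; insertAt)
open import Data.Vec.Properties
  using (insertAt-lookup; insertAt-punchIn; lookup∘tabulate; lookup-map; lookup-zip; map-∘; tabulate-∘)
open import Data.Vec.Relation.Unary.All as All using (All; []; _∷_)
import Data.Vec.Relation.Unary.All.Properties as All
open import Data.Vec.Relation.Unary.AllPairs using ([]; _∷_)
open import Data.Vec.Relation.Unary.Unique.Propositional using (Unique)
import Data.Vec.Relation.Unary.Unique.Propositional.Properties as Unique
open import Function.Base using (_∘_; flip; id; case_of_)
open import Level using (Level)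
open import Relation.Binary.PropositionalEquality.Core as ≡ using (_≡_; _≢_)
open import Relation.Nullary.Decidable using (Dec; yes; no; dec-true; dec-false)

-- The shuffles have their origin in the symmetry of a bᵀ + b aᵀ. Every η offers two rank one
-- summands, so picking one for each member of a sequence E of r quadruples means picking a subset I
-- of its positions. The left vectors picked are then the rows of the shuffle by I and the right
-- vectors those of the shuffle by the complement, and the product of two minors in the Cauchy-Binet
-- formula is one term of `sdet`. Determinants are given by Laplace expansion and not as sums over
-- permutations, so transposition, alternation and multilinearity are all derived by comparing
-- expansions. With sequences in place of sets no ordering of the summands has to be chosen, and r!
-- stays a multiplier instead of a divisor. In det (t + N) the diagonal summands t are treated one
-- index at a time: either t is taken, which deletes the row and column, or it is given up. The
-- matrices in between carry t on a part of the diagonal only, which is why two copies of the index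
-- set are used.

private variable
  n r : ℕ

-- Lists of subsets; preimages under a 4-cycle

increasing-empty : r ℕ.> n → increasing r n ≡ []
increasing-empty {suc r} {zero}  r>n = ≡.refl
increasing-empty {suc r} {suc n} (ℕ.s≤s r>n)
  rewrite increasing-empty r>n | increasing-empty (ℕ.m<n⇒m<1+n r>n) = ≡.refl

increasing-full : ∀ n → increasing n n ≡ Vec.tabulate id ∷ []
increasing-full zero    = ≡.refl
increasing-full (suc n)
  rewrite increasing-full n | increasing-empty (ℕ.n<1+n n) =
  ≡.cong (λ u → (zero ∷ u) ∷ []) (≡.sym (tabulate-∘ suc id))

module _ {n : ℕ} where

  transpose-first : (i j : Fin n) → transpose i j i ≡ j
  transpose-first i j rewrite dec-true (i ≟ i) ≡.refl = ≡.refl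

  transpose-second : (i j : Fin n) → transpose i j j ≡ i
  transpose-second i j with j ≟ i
  ... | yes j≡i = j≡i
  ... | no  _   rewrite dec-true (j ≟ j) ≡.refl = ≡.refl

  transpose-other : (i j : Fin n) {p : Fin n} → p ≢ i → p ≢ j → transpose i j p ≡ p
  transpose-other i j {p} p≢i p≢j rewrite dec-false (p ≟ i) p≢i | dec-false (p ≟ j) p≢j = ≡.refl

  module _ (i j k l : Fin n) where

    -- Row p of the matrix of a permutation is read off at the preimage of p. It unfolds to three
    -- transpositions with i, the one with l acting first, and the lemmas below follow one point
    -- through them.
    preimage : Fin n → Fin n
    preimage p = cycle i j k l ⟨$⟩ˡ p

    preimage-first : l ≢ i → l ≢ j → l ≢ k → preimage i ≡ l
    preimage-first l≢i l≢j l≢k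
      rewrite transpose-second l i | transpose-other k i l≢k l≢i = transpose-other j i l≢j l≢i

    preimage-fourth : k ≢ i → k ≢ j → preimage l ≡ k
    preimage-fourth k≢i k≢j
      rewrite transpose-first l i | transpose-second k i = transpose-other j i k≢j k≢i

    preimage-third : k ≢ i → k ≢ l → preimage k ≡ j
    preimage-third k≢i k≢l
      rewrite transpose-other l i k≢l k≢i | transpose-first k i = transpose-second j i

    preimage-second : j ≢ i → j ≢ k → j ≢ l → preimage j ≡ i
    preimage-second j≢i j≢k j≢l
      rewrite transpose-other l i j≢l j≢i | transpose-other k i j≢k j≢i = transpose-first j i

    preimage-other : ∀ {p} → p ≢ i → p ≢ j → p ≢ k → p ≢ l → preimage p ≡ p
    preimage-other p≢i p≢j p≢k p≢l
      rewrite transpose-other l i p≢l p≢i | transpose-other k i p≢k p≢i = transpose-other j i p≢j p≢i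

increasing-unique : ∀ r n → ListAll.All Unique (increasing r n)
increasing-unique zero    n       = [] ∷ []
increasing-unique (suc r) zero    = []
increasing-unique (suc r) (suc n) = ListAll.++⁺
  (ListAll.map⁺ (ListAll.map (λ {J} J! → All.map⁺ (All.universal (λ _ ()) J) ∷ Unique.map⁺ suc-injective J!) (increasing-unique r n)))
  (ListAll.map⁺ (ListAll.map (Unique.map⁺ suc-injective) (increasing-unique (suc r) n)))

module Development {c ℓ} (K : CommutativeRing c ℓ) where

  open LieElement K
  open CommutativeRing K
    hiding (Carrier; _≈_; _+_; _*_; -_; _-_; 0#; 1#; zero)
  open import Algebra.Properties.Ring ring
    using (-‿distribʳ-*; -0#≈0#; -‿involutive; -‿+-comm; -1*x≈-x; ⁻¹-anti-homo‿-)
  open import Algebra.Properties.Semiring.Sum semiring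
    using (sum-cong-≋; sum-init-last; sum-replicate; *-distribˡ-sum; ∑-comm; ∑-distrib-+)
  open import Algebra.Properties.Semiring.Mult semiring using (×-congʳ; ×-assocˡ; ×-comm-*)
  open import Algebra.Solver.Ring.NaturalCoefficients.Default commutativeSemiring
    using (solve; _:=_; _:+_; _:*_)
  open import Relation.Binary.Reasoning.Setoid setoid

  private variable
    m : ℕ
    a : Level
    X Y : Set a
    E : Set

  -- Signs, finite sums and linear extension to tensor powers

  sign : Fin n → Carrier
  sign j = (- 1#) ^ toℕ j

  sign² : (j : Fin n) → sign j * sign j ≈ 1#
  sign² zero    = *-identityˡ 1#
  sign² (suc j) = begin
    (- 1# * sign j) * (- 1# * sign j)   ≈⟨ solve 2 (λ u s → (u :* s) :* (u :* s) := (u :* u) :* (s :* s)) refl (- 1#) (sign j) ⟩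
    (- 1# * - 1#) * (sign j * sign j)   ≈⟨ *-cong (trans (-1*x≈-x _) (-‿involutive 1#)) (sign² j) ⟩
    1# * 1#                             ≈⟨ *-identityˡ 1# ⟩
    1#                                  ∎

  -- Opaque copies of sum and det: the originals unfold at successor sizes, and
  -- then the summand or the matrix can no longer be inferred.
  abstract

    ∑ : (Fin n → Carrier) → Carrier
    ∑ = sum

    ∑≈sum : (f : Fin n → Carrier) → ∑ f ≈ sum f
    ∑≈sum f = refl

    ∑-empty : (f : Fin 0 → Carrier) → ∑ f ≈ 0#
    ∑-empty f = refl

    ∑-suc : (f : Fin (suc n) → Carrier) → ∑ f ≈ f zero + ∑ (f ∘ suc)
    ∑-suc f = refl

    ∑-cong : {f g : Fin n → Carrier} → (∀ i → f i ≈ g i) → ∑ f ≈ ∑ g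
    ∑-cong = sum-cong-≋

    ∑-+ : (f g : Fin n → Carrier) → ∑ (λ i → f i + g i) ≈ ∑ f + ∑ g
    ∑-+ = ∑-distrib-+

    ∑-*ˡ : (k : Carrier) (f : Fin n → Carrier) → k * ∑ f ≈ ∑ (λ i → k * f i)
    ∑-*ˡ = *-distribˡ-sum

    ∑-swap : (f : Fin m → Fin n → Carrier) → ∑ (λ i → ∑ (f i)) ≈ ∑ (λ j → ∑ (λ i → f i j))
    ∑-swap = ∑-comm

    ∑-const : (n : ℕ) (x : Carrier) → ∑ {n} (λ _ → x) ≈ n · x
    ∑-const n x = sum-replicate n

    Det : Matrix n n → Carrier
    Det = det

    Det≈det : (A : Matrix n n) → Det A ≈ det A
    Det≈det A = refl

    Det-empty : (A : Matrix 0 0) → Det A ≈ 1#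
    Det-empty A = refl

    Det-expandRow : (A : Matrix (suc n) (suc n)) →
      Det A ≈ ∑ λ j → sign j * (A zero j * Det λ p q → A (suc p) (punchIn j q))
    Det-expandRow A = refl

  ∑-zero : {f : Fin n → Carrier} → (∀ i → f i ≈ 0#) → ∑ f ≈ 0#
  ∑-zero {n} {f} f≈0 = begin
    -- Zero is written as a product so that a factor zero can be pulled out of the opaque sum.
    ∑ f                 ≈⟨ ∑-cong (λ i → trans (f≈0 i) (sym (zeroˡ 0#))) ⟩
    ∑ (λ i → 0# * 0#)   ≈⟨ ∑-*ˡ {n} 0# (λ _ → 0#) ⟨
    0# * ∑ {n} (λ _ → 0#)   ≈⟨ zeroˡ _ ⟩
    0#                  ∎

  ∑-neg : (f : Fin n → Carrier) → ∑ (λ i → - f i) ≈ - ∑ f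
  ∑-neg f = begin
    ∑ (λ i → - f i)       ≈⟨ ∑-cong (λ i → -1*x≈-x (f i)) ⟨
    ∑ (λ i → - 1# * f i)  ≈⟨ ∑-*ˡ (- 1#) f ⟨
    - 1# * ∑ f            ≈⟨ -1*x≈-x _ ⟩
    - ∑ f                 ∎

  sumOver-cong : (xs : List X) {f g : X → Carrier} → (∀ x → f x ≈ g x) →
                 sumOver xs f ≈ sumOver xs g
  sumOver-cong []       f≈g = refl
  sumOver-cong (x ∷ xs) f≈g = +-cong (f≈g x) (sumOver-cong xs f≈g)

  sumOver-zero : (xs : List X) → sumOver xs (λ _ → 0#) ≈ 0#
  sumOver-zero []       = refl
  sumOver-zero (x ∷ xs) = trans (+-identityˡ _) (sumOver-zero xs)

  sumOver-+ : (xs : List X) (f g : X → Carrier) →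
              sumOver xs (λ x → f x + g x) ≈ sumOver xs f + sumOver xs g
  sumOver-+ []       f g = sym (+-identityˡ 0#)
  sumOver-+ (x ∷ xs) f g = begin
    (f x + g x) + sumOver xs (λ y → f y + g y)          ≈⟨ +-congˡ (sumOver-+ xs f g) ⟩
    (f x + g x) + (sumOver xs f + sumOver xs g)         ≈⟨ solve 4 (λ a b c d → (a :+ b) :+ (c :+ d) := (a :+ c) :+ (b :+ d)) refl _ _ _ _ ⟩
    (f x + sumOver xs f) + (g x + sumOver xs g)         ∎

  sumOver-*ˡ : (xs : List X) (k : Carrier) (f : X → Carrier) →
               k * sumOver xs f ≈ sumOver xs (λ x → k * f x)
  sumOver-*ˡ []       k f = zeroʳ k
  sumOver-*ˡ (x ∷ xs) k f = trans (distribˡ k _ _) (+-congˡ (sumOver-*ˡ xs k f))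

  sumOver-· : (k : ℕ) (xs : List X) (f : X → Carrier) →
              sumOver xs (λ x → k · f x) ≈ k · sumOver xs f
  sumOver-· zero    xs f = sumOver-zero xs
  sumOver-· (suc k) xs f = trans (sumOver-+ xs f _) (+-congˡ (sumOver-· k xs f))

  sumOver-++ : (xs ys : List X) (f : X → Carrier) →
               sumOver (xs ++ ys) f ≈ sumOver xs f + sumOver ys f
  sumOver-++ []       ys f = sym (+-identityˡ _)
  sumOver-++ (x ∷ xs) ys f = trans (+-congˡ (sumOver-++ xs ys f)) (sym (+-assoc _ _ _))

  sumOver-map : (g : X → Y) (xs : List X) (f : Y → Carrier) →
                sumOver (List.map g xs) f ≈ sumOver xs (f ∘ g)
  sumOver-map g []       f = refl
  sumOver-map g (x ∷ xs) f = +-congˡ (sumOver-map g xs f)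

  sumOver-comm : (xs : List X) (ys : List Y) (f : X → Y → Carrier) →
                 sumOver xs (λ x → sumOver ys (f x)) ≈ sumOver ys (λ y → sumOver xs (λ x → f x y))
  sumOver-comm []       ys f = sym (sumOver-zero ys)
  sumOver-comm (x ∷ xs) ys f = begin
    sumOver ys (f x) + sumOver xs (λ x′ → sumOver ys (f x′))          ≈⟨ +-congˡ (sumOver-comm xs ys f) ⟩
    sumOver ys (f x) + sumOver ys (λ y → sumOver xs (λ x′ → f x′ y))  ≈⟨ sumOver-+ ys _ _ ⟨
    sumOver ys (λ y → f x y + sumOver xs (λ x′ → f x′ y))             ∎

  sumOver-∑ : (xs : List X) (f : X → Fin n → Carrier) →
                sumOver xs (λ x → ∑ (f x)) ≈ ∑ (λ j → sumOver xs (λ x → f x j))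
  sumOver-∑ {n = n} []       f = sym (∑-zero {n} λ _ → refl)
  sumOver-∑         (x ∷ xs) f =
    trans (+-congˡ (sumOver-∑ xs f)) (sym (∑-+ (f x) _))

  module _ {E : Set} where

    extend-cong : (x : Lin E) {f g : E → Carrier} → (∀ e → f e ≈ g e) →
                  extendLinearly f x ≈ extendLinearly g x
    extend-cong x f≈g = sumOver-cong x λ (a , e) → *-congˡ (f≈g e)

    extend-+ : (x : Lin E) (f g : E → Carrier) →
               extendLinearly (λ e → f e + g e) x ≈ extendLinearly f x + extendLinearly g x
    extend-+ x f g = trans (sumOver-cong x λ (a , e) → distribˡ a _ _) (sumOver-+ x _ _)

    extend-*ˡ : (x : Lin E) (k : Carrier) (f : E → Carrier) →
                k * extendLinearly f x ≈ extendLinearly (λ e → k * f e) x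
    extend-*ˡ x k f = trans (sumOver-*ˡ x k _)
      (sumOver-cong x λ (a , e) → solve 3 (λ k a f → k :* (a :* f) := a :* (k :* f)) refl k a (f e))

    extend-sumOver : (x : Lin E) (ys : List Y) (f : E → Y → Carrier) →
                     extendLinearly (λ e → sumOver ys (f e)) x ≈
                     sumOver ys (λ y → extendLinearly (λ e → f e y) x)
    extend-sumOver x ys f = trans (sumOver-cong x λ (a , e) → sumOver-*ˡ ys a _) (sumOver-comm x ys _)

    extend-∑ : (x : Lin E) (f : E → Fin n → Carrier) →
                 extendLinearly (λ e → ∑ (f e)) x ≈ ∑ (λ j → extendLinearly (λ e → f e j) x)
    extend-∑ x f = trans (sumOver-cong x λ (a , e) → ∑-*ˡ a _) (sumOver-∑ x _)

  extend-comm : {E D : Set} (x : Lin E) (y : Lin D) (f : E → D → Carrier) →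
                extendLinearly (λ e → extendLinearly (f e) y) x ≈
                extendLinearly (λ d → extendLinearly (λ e → f e d) x) y
  extend-comm x y f = trans (extend-sumOver x y λ e (b , d) → b * f e d)
    (sumOver-cong y λ (b , d) → sym (extend-*ˡ x b (λ e → f e d)))

  extend-⊗ : {E : Set} (x : Lin E) (f : Vec E (suc r) → Carrier) →
             extendLinearly f (x ⊗^ suc r) ≈
             extendLinearly (λ e → extendLinearly (λ es → f (e ∷ es)) (x ⊗^ r)) x
  extend-⊗ {r} x f = go x (x ⊗^ r)
    where
    go : ∀ x y → extendLinearly f (cartesianProductWith (λ (a , e) (b , es) → a * b , e ∷ es) x y) ≈
                 extendLinearly (λ e → extendLinearly (λ es → f (e ∷ es)) y) x
    go []            y = refl
    go ((a , e) ∷ x) y = begin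
      extendLinearly f (List.map (λ (b , es) → a * b , e ∷ es) y ++ _)    ≈⟨ sumOver-++ (List.map _ y) _ _ ⟩
      extendLinearly f (List.map (λ (b , es) → a * b , e ∷ es) y) + _     ≈⟨ +-cong (sumOver-map _ y _) (go x y) ⟩
      sumOver y (λ (b , es) → a * b * f (e ∷ es)) + _                     ≈⟨ +-congʳ (sumOver-cong y λ _ → *-assoc _ _ _) ⟩
      sumOver y (λ (b , es) → a * (b * f (e ∷ es))) + _                   ≈⟨ +-congʳ (sumOver-*ˡ y a _) ⟨
      a * extendLinearly (λ es → f (e ∷ es)) y + _                        ∎

  -- All tensor factors are the same `x` and sums over different factors commute, so any position
  -- can be singled out in place of the first. This isolates the factor that a column expansion
  -- selects.
  extend-insertAt : {E : Set} (x : Lin E) (j : Fin (suc r)) (f : Vec E (suc r) → Carrier) →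
                    extendLinearly f (x ⊗^ suc r) ≈
                    extendLinearly (λ e → extendLinearly (λ es → f (insertAt es j e)) (x ⊗^ r)) x
  extend-insertAt         x zero    f = extend-⊗ x f
  extend-insertAt {suc r} x (suc j) f = begin
    extendLinearly f (x ⊗^ suc (suc r))
      ≈⟨ extend-⊗ x f ⟩
    extendLinearly (λ e → extendLinearly (λ es → f (e ∷ es)) (x ⊗^ suc r)) x
      ≈⟨ extend-cong x (λ e → extend-insertAt x j (f ∘ (e ∷_))) ⟩
    extendLinearly (λ e → extendLinearly (λ d → extendLinearly (λ es → f (e ∷ insertAt es j d)) (x ⊗^ r)) x) x
      ≈⟨ extend-comm x x _ ⟩
    extendLinearly (λ d → extendLinearly (λ e → extendLinearly (λ es → f (e ∷ insertAt es j d)) (x ⊗^ r)) x) x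
      ≈⟨ extend-cong x (λ d → extend-⊗ x (λ es → f (insertAt es (suc j) d))) ⟨
    extendLinearly (λ d → extendLinearly (λ es → f (insertAt es (suc j) d)) (x ⊗^ suc r)) x ∎

  -- Determinants: column expansion, transposition, alternation

  Det-cong : {A B : Matrix n n} → (∀ p q → A p q ≈ B p q) → Det A ≈ Det B
  Det-cong {zero}  {A} {B} A≈B = trans (Det-empty A) (sym (Det-empty B))
  Det-cong {suc n} {A} {B} A≈B = begin
    Det A                                                                ≈⟨ Det-expandRow A ⟩
    ∑ (λ j → sign j * (A zero j * Det λ p q → A (suc p) (punchIn j q)))  ≈⟨ ∑-cong (λ j → *-congˡ (*-cong (A≈B zero j) (Det-cong λ p q → A≈B (suc p) (punchIn j q)))) ⟩
    ∑ (λ j → sign j * (B zero j * Det λ p q → B (suc p) (punchIn j q)))  ≈⟨ Det-expandRow B ⟨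
    Det B                                                                ∎

  columnTerm : Matrix (suc n) (suc n) → Fin (suc n) → Carrier
  columnTerm A i = sign i * (A i zero * Det λ p q → A (punchIn i p) (suc q))

  -- Apart from the corner term, expanding by the first row and then each minor by its first column
  -- gives a double sum over the deleted pairs of rows and columns. Expanding in the other order
  -- gives the same double sum: the extra factor -1 merely passes from the sign of the column to
  -- that of the row (`exchange`).
  Det-expandColumn : (A : Matrix (suc n) (suc n)) → Det A ≈ ∑ (columnTerm A)
  Det-expandColumn {zero} A = begin
    Det A                                     ≈⟨ Det-expandRow A ⟩
    ∑ (λ j → sign j * (A zero j * Det λ p q → A (suc p) (punchIn j q)))  ≈⟨ ∑-cong (λ { zero → *-congˡ (*-congˡ (trans (Det-empty _) (sym (Det-empty _)))) }) ⟩
    ∑ (columnTerm A)                          ∎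
  Det-expandColumn {suc n} A = begin
    Det A
      ≈⟨ trans (Det-expandRow A) (∑-suc _) ⟩
    columnTerm A zero + ∑ (λ j → sign (suc j) * (A zero (suc j) * Det λ p q → A (suc p) (punchIn (suc j) q)))
      ≈⟨ +-congˡ (∑-cong λ j → trans (*-congˡ (*-congˡ (Det-expandColumn _))) (push (sign (suc j)) (A zero (suc j)) _)) ⟩
    columnTerm A zero + ∑ (λ j → ∑ λ i → sign (suc j) * (A zero (suc j) * (sign i * (A (suc i) zero * D i j))))
      ≈⟨ +-congˡ (∑-swap _) ⟩
    columnTerm A zero + ∑ (λ i → ∑ λ j → sign (suc j) * (A zero (suc j) * (sign i * (A (suc i) zero * D i j))))
      ≈⟨ +-congˡ (∑-cong λ i → ∑-cong λ j → exchange (sign j) (A zero (suc j)) (sign i) (A (suc i) zero) (D i j)) ⟩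
    columnTerm A zero + ∑ (λ i → ∑ λ j → sign (suc i) * (A (suc i) zero * (sign j * (A zero (suc j) * D i j))))
      ≈⟨ +-congˡ (∑-cong λ i → trans (*-congˡ (*-congˡ (Det-expandRow _))) (push (sign (suc i)) (A (suc i) zero) _)) ⟨
    columnTerm A zero + ∑ (columnTerm A ∘ suc)
      ≈⟨ ∑-suc _ ⟨
    ∑ (columnTerm A) ∎
    where
    D : Fin (suc n) → Fin (suc n) → Carrier
    D i j = Det λ p q → A (suc (punchIn i p)) (suc (punchIn j q))

    push : ∀ s a (f : Fin (suc n) → Carrier) → s * (a * ∑ f) ≈ ∑ λ i → s * (a * f i)
    push s a f = trans (*-congˡ (∑-*ˡ a f)) (∑-*ˡ s _)

    exchange : ∀ s a t b d → (- 1# * s) * (a * (t * (b * d))) ≈ (- 1# * t) * (b * (s * (a * d)))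
    exchange = solve 6 (λ u s a t b d → (u :* s) :* (a :* (t :* (b :* d))) :=
                                        (u :* t) :* (b :* (s :* (a :* d)))) refl (- 1#)

  Det-transpose : (A : Matrix n n) → Det A ≈ Det (flip A)
  Det-transpose {zero}  A = trans (Det-empty A) (sym (Det-empty (flip A)))
  Det-transpose {suc n} A = begin
    Det A                                                                ≈⟨ Det-expandRow A ⟩
    ∑ (λ j → sign j * (A zero j * Det λ p q → A (suc p) (punchIn j q)))  ≈⟨ ∑-cong (λ j → *-congˡ (*-congˡ (Det-transpose _))) ⟩
    ∑ (columnTerm (flip A))                                              ≈⟨ Det-expandColumn (flip A) ⟨
    Det (flip A)                                                         ∎

  -- Isolates the first two rows. If they are exchanged, the two leading terms trade places; if they
  -- are equal, these terms cancel. Every other minor still contains both rows, so induction applies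
  -- to it.
  Det-expandColumn₂ : (A : Matrix (suc (suc n)) (suc (suc n))) →
    Det A ≈ A zero zero * Det (λ p q → A (suc p) (suc q)) +
            (- (A (suc zero) zero * Det λ p q → A (punchIn (suc zero) p) (suc q)) +
             ∑ (λ i → columnTerm A (suc (suc i))))
  Det-expandColumn₂ A = begin
    Det A                                                               ≈⟨ Det-expandColumn A ⟩
    ∑ (columnTerm A)                                                    ≈⟨ trans (∑-suc _) (+-congˡ (∑-suc _)) ⟩
    columnTerm A zero + (columnTerm A (suc zero) + ∑ (λ i → columnTerm A (suc (suc i))))
      ≈⟨ +-cong (*-identityˡ _) (+-congʳ (trans (*-congʳ (*-identityʳ _)) (-1*x≈-x _))) ⟩
    _ ∎

  Det-swap : (A B : Matrix (suc (suc n)) (suc (suc n))) →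
             (∀ q → A zero q ≈ B (suc zero) q) → (∀ q → A (suc zero) q ≈ B zero q) →
             (∀ p q → A (suc (suc p)) q ≈ B (suc (suc p)) q) → Det A ≈ - Det B
  Det-swap {n} A B A₀≈B₁ A₁≈B₀ A₂≈B₂ = begin
    Det A
      ≈⟨ Det-expandColumn₂ A ⟩
    A zero zero * M₀ A + (- (A (suc zero) zero * M₁ A) + ∑ (λ i → columnTerm A (suc (suc i))))
      ≈⟨ +-cong (*-cong (A₀≈B₁ zero) (Det-cong λ { zero q → A₁≈B₀ (suc q) ; (suc p) q → A₂≈B₂ p (suc q) }))
        (+-cong (-‿cong (*-cong (A₁≈B₀ zero) (Det-cong λ { zero q → A₀≈B₁ (suc q) ; (suc p) q → A₂≈B₂ p (suc q) })))
          (trans (∑-cong λ i → trans (*-congˡ (*-cong (A₂≈B₂ i zero) (minor i))) (pullNeg _ _ _)) (∑-neg _))) ⟩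
    b₁ + (- b₀ + - b₂)        ≈⟨ solve 3 (λ b₁ b₀ b₂ → b₁ :+ (b₀ :+ b₂) := b₀ :+ (b₁ :+ b₂)) refl b₁ (- b₀) (- b₂) ⟩
    - b₀ + (b₁ + - b₂)        ≈⟨ +-congˡ (+-congʳ (-‿involutive b₁)) ⟨
    - b₀ + (- (- b₁) + - b₂)  ≈⟨ trans (+-congˡ (-‿+-comm _ _)) (-‿+-comm _ _) ⟩
    - (b₀ + (- b₁ + b₂))      ≈⟨ -‿cong (Det-expandColumn₂ B) ⟨
    - Det B                   ∎
    where
    M₀ M₁ : Matrix (suc (suc n)) (suc (suc n)) → Carrier
    M₀ C = Det λ p q → C (suc p) (suc q)
    M₁ C = Det λ p q → C (punchIn (suc zero) p) (suc q)
    b₀ b₁ b₂ : Carrier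
    b₀ = B zero zero * M₀ B
    b₁ = B (suc zero) zero * M₁ B
    b₂ = ∑ λ i → columnTerm B (suc (suc i))
    minor : (i : Fin n) → Det (λ p q → A (punchIn (suc (suc i)) p) (suc q)) ≈
                          - Det (λ p q → B (punchIn (suc (suc i)) p) (suc q))
    -- The case distinction only exhibits n as a successor.
    minor i@zero    = Det-swap _ _ (A₀≈B₁ ∘ suc) (A₁≈B₀ ∘ suc) (λ p → A₂≈B₂ (punchIn i p) ∘ suc)
    minor i@(suc _) = Det-swap _ _ (A₀≈B₁ ∘ suc) (A₁≈B₀ ∘ suc) (λ p → A₂≈B₂ (punchIn i p) ∘ suc)
    pullNeg : ∀ s b d → s * (b * - d) ≈ - (s * (b * d))
    pullNeg s b d = trans (*-congˡ (sym (-‿distribʳ-* _ _))) (sym (-‿distribʳ-* _ _))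

  -- Antisymmetry alone would only give that twice the determinant is zero, and 2 may be a zero
  -- divisor in `K`; hence a separate induction.
  Det-repeat : (A : Matrix (suc (suc n)) (suc (suc n))) →
               (∀ q → A zero q ≈ A (suc zero) q) → Det A ≈ 0#
  Det-repeat {n} A A₀≈A₁ = begin
    Det A
      ≈⟨ Det-expandColumn₂ A ⟩
    A zero zero * Det (λ p q → A (suc p) (suc q)) + (- a₁ + ∑ (λ i → columnTerm A (suc (suc i))))
      ≈⟨ +-cong (*-cong (A₀≈A₁ zero) (Det-cong λ { zero q → sym (A₀≈A₁ (suc q)) ; (suc p) q → refl }))
                (trans (+-congˡ (∑-zero λ i → trans (*-congˡ (trans (*-congˡ (minor i)) (zeroʳ _))) (zeroʳ _))) (+-identityʳ _)) ⟩
    a₁ - a₁ ≈⟨ -‿inverseʳ a₁ ⟩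
    0#      ∎
    where
    a₁ : Carrier
    a₁ = A (suc zero) zero * Det λ p q → A (punchIn (suc zero) p) (suc q)
    minor : (i : Fin n) → Det (λ p q → A (punchIn (suc (suc i)) p) (suc q)) ≈ 0#
    minor zero    = Det-repeat _ (A₀≈A₁ ∘ suc)
    minor (suc i) = Det-repeat _ (A₀≈A₁ ∘ suc)

  -- Exchanges of neighbours suffice for every sign argument below. The two constructors match the
  -- two available tools: `Det-swap` for the top rows, expansion along an unaffected first row for
  -- the others.
  data _⇄_ {E : Set a} : Vec E n → Vec E n → Set a where
    here  : ∀ {x y} {u : Vec E n} → (x ∷ y ∷ u) ⇄ (y ∷ x ∷ u)
    there : ∀ {x} {u v : Vec E n} → u ⇄ v → (x ∷ u) ⇄ (x ∷ v)

  -- Rows are named by labels, so row operations become operations on a vector of labels, and the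
  -- minors of a row expansion have the same form with `punchIn` absorbed into `Y`.
  rowsDet : {E : Set a} → (E → Fin n → Carrier) → Vec E n → Carrier
  rowsDet Y u = Det λ p q → Y (lookup u p) q

  Antisymmetric : {E : Set a} → (Vec E n → Carrier) → Set _
  Antisymmetric D = ∀ {u v} → u ⇄ v → D u ≈ - D v

  rowsDet-antisymmetric : {E : Set a} (Y : E → Fin n → Carrier) → Antisymmetric (rowsDet Y)
  rowsDet-antisymmetric Y here = Det-swap _ _ (λ _ → refl) (λ _ → refl) (λ _ _ → refl)
  rowsDet-antisymmetric Y (there {x = x} {u} {v} u⇄v) = begin
    rowsDet Y (x ∷ u)                                               ≈⟨ Det-expandRow _ ⟩
    ∑ (λ j → sign j * (Y x j * rowsDet (λ e q → Y e (punchIn j q)) u))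
      ≈⟨ ∑-cong (λ j → trans (*-congˡ (trans (*-congˡ (rowsDet-antisymmetric (λ e q → Y e (punchIn j q)) u⇄v)) (sym (-‿distribʳ-* _ _)))) (sym (-‿distribʳ-* _ _))) ⟩
    ∑ (λ j → - (sign j * (Y x j * rowsDet (λ e q → Y e (punchIn j q)) v)))
      ≈⟨ ∑-neg _ ⟩
    - ∑ (λ j → sign j * (Y x j * rowsDet (λ e q → Y e (punchIn j q)) v))
      ≈⟨ -‿cong (Det-expandRow _) ⟨
    - rowsDet Y (x ∷ v)                                             ∎

  -- Once `y` is exchanged to the top, expansion along it leaves minors in which the repeated row is
  -- one place nearer to its copy.
  rowsDet-repeat : {E : Set a} (Y : E → Fin (suc n) → Carrier) (v : Vec E n) (p : Fin n) →
                   rowsDet Y (lookup v p ∷ v) ≈ 0#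
  rowsDet-repeat Y (y ∷ v) zero    = Det-repeat _ (λ _ → refl)
  rowsDet-repeat Y (y ∷ v) (suc p) = begin
    rowsDet Y (lookup v p ∷ y ∷ v)    ≈⟨ rowsDet-antisymmetric Y here ⟩
    - rowsDet Y (y ∷ lookup v p ∷ v)  ≈⟨ -‿cong (Det-expandRow _) ⟩
    - ∑ (λ j → sign j * (Y y j * rowsDet (λ e q → Y e (punchIn j q)) (lookup v p ∷ v)))
      ≈⟨ -‿cong (∑-zero λ j → trans (*-congˡ (trans (*-congˡ (rowsDet-repeat (λ e q → Y e (punchIn j q)) v p)) (zeroʳ _))) (zeroʳ _)) ⟩
    - 0#                              ≈⟨ -0#≈0# ⟩
    0#                                ∎

  antisymmetric-insertAt : {E : Set a} (D : Vec E (suc n) → Carrier) → Antisymmetric D →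
                           ∀ es j e → D (insertAt es j e) ≈ sign j * D (e ∷ es)
  antisymmetric-insertAt D D-anti es       zero    e = sym (*-identityˡ _)
  antisymmetric-insertAt D D-anti (d ∷ es) (suc j) e = begin
    D (d ∷ insertAt es j e)        ≈⟨ antisymmetric-insertAt (D ∘ (d ∷_)) (D-anti ∘ there) es j e ⟩
    sign j * D (d ∷ e ∷ es)        ≈⟨ *-congˡ (trans (D-anti here) (sym (-1*x≈-x _))) ⟩
    sign j * (- 1# * D (e ∷ d ∷ es))  ≈⟨ solve 3 (λ s u d → s :* (u :* d) := (u :* s) :* d) refl _ _ _ ⟩
    sign (suc j) * D (e ∷ d ∷ es)  ∎

  -- Let R v be the determinant with the first row replaced by v. For v another row of the matrix, R
  -- v = 0 by repetition, so Det A equals the sum of R over all rows; by linearity this is R at the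
  -- sum of the rows, which is zero.
  Det-zeroColumnSums : (A : Matrix (suc n) (suc n)) → (∀ q → ∑ (λ p → A p q) ≈ 0#) → Det A ≈ 0#
  Det-zeroColumnSums {n} A ΣA≈0 = begin
    Det A                                    ≈⟨ trans (Det-expandRow A) (sym (+-identityʳ _)) ⟩
    R (A zero) + 0#                          ≈⟨ +-congˡ (∑-zero repeated) ⟨
    R (A zero) + ∑ (λ p → R (A (suc p)))     ≈⟨ ∑-suc _ ⟨
    ∑ (λ p → R (A p))                        ≈⟨ ∑-swap _ ⟩
    ∑ (λ j → ∑ λ p → sign j * (A p j * C j)) ≈⟨ ∑-cong (λ j → trans (∑-cong λ p → swapFactors (sign j) (A p j) (C j)) (sym (∑-*ˡ (sign j * C j) _))) ⟩
    ∑ (λ j → (sign j * C j) * ∑ λ p → A p j) ≈⟨ ∑-zero (λ j → trans (*-congˡ (ΣA≈0 j)) (zeroʳ _)) ⟩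
    0#                                       ∎
    where
    C : Fin (suc n) → Carrier
    C j = Det λ p q → A (suc p) (punchIn j q)
    R : (Fin (suc n) → Carrier) → Carrier
    R v = ∑ λ j → sign j * (v j * C j)
    swapFactors : ∀ s x d → s * (x * d) ≈ (s * d) * x
    swapFactors = solve 3 (λ s x d → s :* (x :* d) := (s :* d) :* x) refl
    tail : Vec (Fin (suc n)) n
    tail = Vec.tabulate suc
    repeated : ∀ p → R (A (suc p)) ≈ 0#
    repeated p = begin
      R (A (suc p))                  ≈⟨ Det-expandRow _ ⟨
      Det (λ { zero q → A (suc p) q ; (suc i) q → A (suc i) q })
        ≈⟨ Det-cong (λ { zero q → reflexive (≡.cong (λ i → A i q) (≡.sym (lookup∘tabulate suc p)))
                       ; (suc i) q → reflexive (≡.cong (λ i → A i q) (≡.sym (lookup∘tabulate suc i))) }) ⟩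
      rowsDet A (lookup tail p ∷ tail) ≈⟨ rowsDet-repeat A tail p ⟩
      0#                             ∎

  -- The Cauchy-Binet formula over sequences

  -- The coefficients `X e p` that come out when one summand is chosen in each row p. They form the
  -- diagonal of the matrix whose determinant is `rowsDet X`.
  diagonalProduct : (E → Fin r → Carrier) → Vec E r → Carrier
  diagonalProduct X []       = 1#
  diagonalProduct X (e ∷ es) = X e zero * diagonalProduct (λ d p → X d (suc p)) es

  -- Multilinearity in the rows, since row p is a combination of the rows `Y e`. This is the half of
  -- Cauchy-Binet without r!; the other half replaces the diagonal product by a determinant.
  Det-linearCombination : (x : Lin E) (X Y : E → Fin r → Carrier) →
    Det (λ p q → extendLinearly (λ e → X e p * Y e q) x) ≈
    extendLinearly (λ es → diagonalProduct X es * rowsDet Y es) (x ⊗^ r)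
  Det-linearCombination {r = zero}  x X Y = begin
    Det _                                ≈⟨ Det-empty _ ⟩
    1#                                   ≈⟨ trans (+-identityʳ _) (trans (*-identityˡ _) (*-identityˡ 1#)) ⟨
    1# * (1# * 1#) + 0#                  ≈⟨ +-congʳ (*-congˡ (*-congˡ (Det-empty _))) ⟨
    extendLinearly (λ es → diagonalProduct X es * rowsDet Y es) (x ⊗^ zero) ∎
  Det-linearCombination {r = suc r} x X Y = begin
    Det (λ p q → extendLinearly (λ e → X e p * Y e q) x)
      ≈⟨ Det-expandRow _ ⟩
    ∑ (λ j → sign j * (extendLinearly (λ e → X e zero * Y e j) x * Det λ p q → extendLinearly (λ e → X e (suc p) * Y e (punchIn j q)) x))
      ≈⟨ ∑-cong (λ j → trans (*-congˡ (*-congˡ (Det-linearCombination x X′ (λ e q → Y e (punchIn j q))))) (expand j)) ⟩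
    ∑ (λ j → extendLinearly (λ e → extendLinearly (λ es → (X e zero * diagonalProduct X′ es) * (sign j * (Y e j * minor j es))) (x ⊗^ r)) x)
      ≈⟨ trans (extend-cong x λ e → extend-∑ (x ⊗^ r) _) (extend-∑ x _) ⟨
    extendLinearly (λ e → extendLinearly (λ es → ∑ λ j → (X e zero * diagonalProduct X′ es) * (sign j * (Y e j * minor j es))) (x ⊗^ r)) x
      ≈⟨ extend-cong x (λ e → extend-cong (x ⊗^ r) λ es → trans (*-congˡ (Det-expandRow _)) (∑-*ˡ _ _)) ⟨
    extendLinearly (λ e → extendLinearly (λ es → diagonalProduct X (e ∷ es) * rowsDet Y (e ∷ es)) (x ⊗^ r)) x
      ≈⟨ extend-⊗ x _ ⟨
    extendLinearly (λ es → diagonalProduct X es * rowsDet Y es) (x ⊗^ suc r) ∎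
    where
    X′ : _ → Fin r → Carrier
    X′ e p = X e (suc p)
    minor : Fin (suc r) → Vec _ r → Carrier
    minor j = rowsDet λ e q → Y e (punchIn j q)
    expand : ∀ j → sign j * (extendLinearly (λ e → X e zero * Y e j) x * extendLinearly (λ es → diagonalProduct X′ es * minor j es) (x ⊗^ r)) ≈
                   extendLinearly (λ e → extendLinearly (λ es → (X e zero * diagonalProduct X′ es) * (sign j * (Y e j * minor j es))) (x ⊗^ r)) x
    expand j = begin
      sign j * (extendLinearly (λ e → X e zero * Y e j) x * T)
        ≈⟨ solve 3 (λ s a t → s :* (a :* t) := (s :* t) :* a) refl _ _ _ ⟩
      (sign j * T) * extendLinearly (λ e → X e zero * Y e j) x
        ≈⟨ extend-*ˡ x _ _ ⟩
      extendLinearly (λ e → (sign j * T) * (X e zero * Y e j)) x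
        ≈⟨ extend-cong x (λ e → trans (solve 4 (λ s t a b → (s :* t) :* (a :* b) := (s :* (a :* b)) :* t) refl _ _ _ _) (extend-*ˡ (x ⊗^ r) _ _)) ⟩
      extendLinearly (λ e → extendLinearly (λ es → (sign j * (X e zero * Y e j)) * (diagonalProduct X′ es * minor j es)) (x ⊗^ r)) x
        ≈⟨ extend-cong x (λ e → extend-cong (x ⊗^ r) λ es →
             solve 5 (λ s a b d t → (s :* (a :* b)) :* (d :* t) := (a :* d) :* (s :* (b :* t))) refl _ _ _ _ _) ⟩
      _ ∎
      where T = extendLinearly (λ es → diagonalProduct X′ es * minor j es) (x ⊗^ r)

  -- Column expansion: moving the j-th tensor factor to the front costs sign j in
  -- D, which cancels the sign of the j-th cofactor, so all r cofactors contribute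
  -- the same amount.
  rowsDet-antisymmetrizes : (x : Lin E) (X : E → Fin r → Carrier)
    (D : Vec E r → Carrier) → Antisymmetric D →
    extendLinearly (λ es → rowsDet X es * D es) (x ⊗^ r) ≈
    (r !) · extendLinearly (λ es → diagonalProduct X es * D es) (x ⊗^ r)
  rowsDet-antisymmetrizes {r = zero}  x X D anti =
    trans (+-congʳ (*-congˡ (*-congʳ (Det-empty _)))) (sym (+-identityʳ _))
  rowsDet-antisymmetrizes {r = suc r} x X D anti = begin
    extendLinearly (λ es → rowsDet X es * D es) (x ⊗^ suc r)
      ≈⟨ extend-cong (x ⊗^ suc r) (λ es → trans (*-congʳ (Det-expandColumn _)) (trans (*-comm _ _) (∑-*ˡ (D es) _))) ⟩
    extendLinearly (λ es → ∑ λ j → D es * columnTerm (λ p q → X (lookup es p) q) j) (x ⊗^ suc r)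
      ≈⟨ extend-∑ (x ⊗^ suc r) _ ⟩
    ∑ (λ j → extendLinearly (λ es → D es * columnTerm (λ p q → X (lookup es p) q) j) (x ⊗^ suc r))
      ≈⟨ ∑-cong (λ j → trans (extend-insertAt x j _) (extend-cong x λ e → extend-cong (x ⊗^ r) λ es → cofactor j e es)) ⟩
    ∑ {suc r} (λ j → extendLinearly (λ e → extendLinearly (λ es → X e zero * (rowsDet X′ es * D (e ∷ es))) (x ⊗^ r)) x)
      ≈⟨ ∑-const (suc r) _ ⟩
    suc r · extendLinearly (λ e → extendLinearly (λ es → X e zero * (rowsDet X′ es * D (e ∷ es))) (x ⊗^ r)) x
      ≈⟨ ×-congʳ (suc r) (extend-cong x λ e → trans (sym (extend-*ˡ (x ⊗^ r) _ _)) (trans (*-congˡ (rowsDet-antisymmetrizes x X′ (D ∘ (e ∷_)) (anti ∘ there)))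
           (×-comm-* (r !) _ _))) ⟩
    suc r · extendLinearly (λ e → (r !) · (X e zero * extendLinearly (λ es → diagonalProduct X′ es * D (e ∷ es)) (x ⊗^ r))) x
      ≈⟨ ×-congʳ (suc r) (trans (extend-· (r !) x _) (×-congʳ (r !) (trans (extend-cong x λ e → trans (extend-*ˡ (x ⊗^ r) _ _) (extend-cong (x ⊗^ r) λ es → sym (*-assoc _ _ _))) (sym (extend-⊗ x _))))) ⟩
    suc r · ((r !) · extendLinearly (λ es → diagonalProduct X es * D es) (x ⊗^ suc r))
      ≈⟨ ×-assocˡ _ (suc r) (r !) ⟩
    (suc r !) · extendLinearly (λ es → diagonalProduct X es * D es) (x ⊗^ suc r) ∎
    where
    X′ : _ → Fin r → Carrier
    X′ e p = X e (suc p)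
    extend-· : ∀ k (x : Lin E) f → extendLinearly (λ e → k · f e) x ≈ k · extendLinearly f x
    extend-· k x f = trans (sumOver-cong x λ (a , e) → ×-comm-* k a (f e)) (sumOver-· k x _)
    cofactor : ∀ j e es → D (insertAt es j e) * columnTerm (λ p q → X (lookup (insertAt es j e) p) q) j ≈
                          X e zero * (rowsDet X′ es * D (e ∷ es))
    cofactor j e es = begin
      D (insertAt es j e) * (sign j * (X (lookup (insertAt es j e) j) zero * Det (λ p q → X (lookup (insertAt es j e) (punchIn j p)) (suc q))))
        ≈⟨ *-cong (antisymmetric-insertAt D anti es j e)
             (*-congˡ (*-cong (reflexive (≡.cong (λ d → X d zero) (insertAt-lookup es j e)))
                              (Det-cong λ p q → reflexive (≡.cong (λ d → X d (suc q)) (insertAt-punchIn es j e p))))) ⟩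
      (sign j * D (e ∷ es)) * (sign j * (X e zero * rowsDet X′ es))
        ≈⟨ solve 4 (λ s d a m → (s :* d) :* (s :* (a :* m)) := (s :* s) :* (a :* (m :* d))) refl _ _ _ _ ⟩
      (sign j * sign j) * (X e zero * (rowsDet X′ es * D (e ∷ es)))
        ≈⟨ trans (*-congʳ (sign² j)) (*-identityˡ _) ⟩
      X e zero * (rowsDet X′ es * D (e ∷ es)) ∎

  Det-CauchyBinet : (x : Lin E) (X Y : E → Fin r → Carrier) →
    (r !) · Det (λ p q → extendLinearly (λ e → X e p * Y e q) x) ≈
    extendLinearly (λ es → rowsDet X es * rowsDet Y es) (x ⊗^ r)
  Det-CauchyBinet {r = r} x X Y =
    trans (×-congʳ (r !) (Det-linearCombination x X Y))
          (sym (rowsDet-antisymmetrizes x X (rowsDet Y) (rowsDet-antisymmetric Y)))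

  -- The bit says which of the two rank one summands of a quadruple is meant. In a tensor power the
  -- bits of a sequence make up the subset I of the shuffle determinant.
  bothSides : Lin E → Lin (E × Bool)
  bothSides = concatMap λ (a , e) → (a , e , outside) ∷ (a , e , inside) ∷ []

  extend-bothSides : (x : Lin E) (f : E × Bool → Carrier) →
    extendLinearly f (bothSides x) ≈ extendLinearly (λ e → f (e , outside) + f (e , inside)) x
  extend-bothSides []            f = refl
  extend-bothSides ((a , e) ∷ x) f = begin
    a * f (e , outside) + (a * f (e , inside) + extendLinearly f (bothSides x))  ≈⟨ +-assoc _ _ _ ⟨
    (a * f (e , outside) + a * f (e , inside)) + extendLinearly f (bothSides x)  ≈⟨ +-cong (sym (distribˡ a _ _)) (extend-bothSides x f) ⟩
    _ ∎

  extend-bothSides-⊗ : ∀ r (x : Lin E) (f : Vec (E × Bool) r → Carrier) →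
    extendLinearly f (bothSides x ⊗^ r) ≈
    extendLinearly (λ es → sumOver (subsets r) λ I → f (Vec.zip es I)) (x ⊗^ r)
  extend-bothSides-⊗ zero    x f = +-congʳ (*-congˡ (sym (+-identityʳ _)))
  extend-bothSides-⊗ (suc r) x f = begin
    extendLinearly f (bothSides x ⊗^ suc r)
      ≈⟨ extend-⊗ (bothSides x) f ⟩
    extendLinearly (λ e → extendLinearly (λ es → f (e ∷ es)) (bothSides x ⊗^ r)) (bothSides x)
      ≈⟨ extend-bothSides x _ ⟩
    extendLinearly (λ e → extendLinearly (λ es → f ((e , outside) ∷ es)) (bothSides x ⊗^ r) +
                          extendLinearly (λ es → f ((e , inside) ∷ es)) (bothSides x ⊗^ r)) x
      ≈⟨ extend-cong x (λ e → trans (+-cong (extend-bothSides-⊗ r x _) (extend-bothSides-⊗ r x _)) (sym (extend-+ (x ⊗^ r) _ _))) ⟩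
    extendLinearly (λ e → extendLinearly (λ es → sumOver (subsets r) (λ I → f ((e , outside) ∷ Vec.zip es I)) +
                                                 sumOver (subsets r) (λ I → f ((e , inside) ∷ Vec.zip es I))) (x ⊗^ r)) x
      ≈⟨ extend-cong x (λ e → extend-cong (x ⊗^ r) λ es →
           trans (sumOver-++ (List.map (outside ∷_) (subsets r)) _ _) (+-cong (sumOver-map _ (subsets r) _) (sumOver-map _ (subsets r) _))) ⟨
    extendLinearly (λ e → extendLinearly (λ es → sumOver (subsets (suc r)) λ I → f (Vec.zip (e ∷ es) I)) (x ⊗^ r)) x
      ≈⟨ extend-⊗ x _ ⟨
    extendLinearly (λ es → sumOver (subsets (suc r)) λ I → f (Vec.zip es I)) (x ⊗^ suc r) ∎

  -- Expansion of det (t + N) into principal minors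

  Symmetric : {I : Set} → (∀ {k} → Vec I k → Carrier) → Set _
  Symmetric F = ∀ {k} {u v : Vec _ k} → u ⇄ v → F u ≈ F v

  principalDet : {I : Set} → (I → I → Carrier) → Vec I n → Carrier
  principalDet M u = Det λ p q → M (lookup u p) (lookup u q)

  -- Rows and columns are exchanged simultaneously, and the two signs cancel.
  principalDet-symmetric : {I : Set} (M : I → I → Carrier) → Symmetric (principalDet M)
  principalDet-symmetric M {u = u} {v} u⇄v = begin
    Det (λ p q → M (lookup u p) (lookup u q))      ≈⟨ rowsDet-antisymmetric (λ e q → M e (lookup u q)) u⇄v ⟩
    - Det (λ p q → M (lookup v p) (lookup u q))    ≈⟨ -‿cong (Det-transpose _) ⟩
    - Det (λ q p → M (lookup v p) (lookup u q))    ≈⟨ -‿cong (rowsDet-antisymmetric (λ e p → M (lookup v p) e) u⇄v) ⟩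
    - - Det (λ q p → M (lookup v p) (lookup v q))  ≈⟨ -‿involutive _ ⟩
    Det (λ q p → M (lookup v p) (lookup v q))      ≈⟨ Det-transpose _ ⟨
    Det (λ p q → M (lookup v p) (lookup v q))      ∎

  symmetric-bringToFront : {I : Set} (F : ∀ {k} → Vec I k → Carrier) → Symmetric F →
    ∀ {m k} (w : Vec I m) x (u : Vec I k) → F (w Vec.++ x ∷ u) ≈ F (x ∷ w Vec.++ u)
  symmetric-bringToFront F F-sym []      x u = refl
  symmetric-bringToFront F F-sym (y ∷ w) x u =
    trans (symmetric-bringToFront (F ∘ (y ∷_)) (F-sym ∘ there) w x u) (F-sym here)

  -- Coefficients are counted from the leading one, as the μ_r are, so that multiplication by t
  -- raises the degree without renumbering them.
  evaluate : (ℕ → Carrier) → Carrier → ℕ → Carrier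
  evaluate a t m = ∑ {suc m} λ i → a (toℕ i) * t ^ (m ∸ toℕ i)

  -- In degree m + 1 there is one more coefficient, `a (suc m)`; the hypothesis lets it be added to
  -- the left side for free.
  evaluate-shift : ∀ (a : ℕ → Carrier) t m → a (suc m) ≈ 0# →
    t * evaluate a t m ≈ a 0 * t ^ suc m + evaluate (a ∘ suc) t m
  evaluate-shift a t m a≈0 = begin
    t * evaluate a t m                          ≈⟨ ∑-*ˡ {suc m} t _ ⟩
    ∑ {suc m} (λ i → t * (a (toℕ i) * t ^ (m ∸ toℕ i)))  ≈⟨ go a m a≈0 ⟩
    a 0 * t ^ suc m + evaluate (a ∘ suc) t m    ∎
    where
    swapˡ : ∀ x y z → x * (y * z) ≈ y * (x * z)
    swapˡ = solve 3 (λ x y z → x :* (y :* z) := y :* (x :* z)) refl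
    go : ∀ a m → a (suc m) ≈ 0# →
         ∑ {suc m} (λ i → t * (a (toℕ i) * t ^ (m ∸ toℕ i))) ≈ a 0 * t ^ suc m + evaluate (a ∘ suc) t m
    go a zero    a≈0 = begin
      ∑ {1} (λ i → t * (a (toℕ i) * t ^ (0 ∸ toℕ i)))   ≈⟨ trans (∑-suc _) (+-cong (swapˡ t (a 0) 1#) (∑-empty _)) ⟩
      a 0 * t ^ 1 + 0#                            ≈⟨ +-congˡ (trans (∑-suc _) (trans (+-cong (trans (*-congʳ a≈0) (zeroˡ _)) (∑-empty _)) (+-identityˡ 0#))) ⟨
      a 0 * t ^ 1 + evaluate (a ∘ suc) t 0        ∎
    go a (suc m) a≈0 = begin
      ∑ {suc (suc m)} (λ i → t * (a (toℕ i) * t ^ (suc m ∸ toℕ i)))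
        ≈⟨ ∑-suc _ ⟩
      t * (a 0 * t ^ suc m) + ∑ {suc m} (λ i → t * (a (suc (toℕ i)) * t ^ (m ∸ toℕ i)))
        ≈⟨ +-cong (swapˡ _ _ _) (go (a ∘ suc) m a≈0) ⟩
      a 0 * t ^ suc (suc m) + (a 1 * t ^ suc m + evaluate (λ i → a (suc (suc i))) t m)
        ≈⟨ +-congˡ (∑-suc {suc m} _) ⟨
      a 0 * t ^ suc (suc m) + evaluate (a ∘ suc) t (suc m) ∎

  -- Pascal's rule for sums over subsets: `d` will stand for all subsets, `b` for those that contain
  -- the first index and `a` for those that avoid it.
  evaluate-recurrence : ∀ (a b d : ℕ → Carrier) t m → a (suc m) ≈ 0# →
    d 0 ≈ a 0 → (∀ r → d (suc r) ≈ b r + a (suc r)) →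
    t * evaluate a t m + evaluate b t m ≈ evaluate d t (suc m)
  evaluate-recurrence a b d t m a≈0 d₀ d₊ = begin
    t * evaluate a t m + evaluate b t m                               ≈⟨ +-congʳ (evaluate-shift a t m a≈0) ⟩
    (a 0 * t ^ suc m + evaluate (a ∘ suc) t m) + evaluate b t m       ≈⟨ trans (+-assoc _ _ _) (+-congˡ (+-comm _ _)) ⟩
    a 0 * t ^ suc m + (evaluate b t m + evaluate (a ∘ suc) t m)       ≈⟨ +-congˡ (∑-+ {suc m} _ _) ⟨
    a 0 * t ^ suc m + ∑ {suc m} (λ i → b (toℕ i) * t ^ (m ∸ toℕ i) + a (suc (toℕ i)) * t ^ (m ∸ toℕ i))
      ≈⟨ +-cong (*-congʳ d₀) (∑-cong {suc m} λ i → trans (*-congʳ (d₊ (toℕ i))) (distribʳ _ _ _)) ⟨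
    d 0 * t ^ suc m + ∑ {suc m} (λ i → d (suc (toℕ i)) * t ^ (m ∸ toℕ i))
      ≈⟨ ∑-suc {suc m} _ ⟨
    evaluate d t (suc m) ∎

  -- An index inj₁ p carries the summand t on the diagonal, an index inj₂ p does not.
  module _ {n : ℕ} (t : Carrier) where

    -- Describes the state of the recursion: the indices in `v` have given up their t, `p` is next,
    -- those in `u` are untreated. Since `v` is arbitrary, the property passes to `F` with an index
    -- `inj₂ q` put in front, as the induction on the index list requires.
    Splits : (∀ {k} → Vec (Fin n ⊎ Fin n) k → Carrier) → Set _
    Splits F = ∀ {m k} (v : Vec (Fin n) m) p (u : Vec (Fin n) k) → All (p ≢_) u →
      F (Vec.map inj₂ v Vec.++ inj₁ p ∷ Vec.map inj₁ u) ≈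
      t * F (Vec.map inj₂ v Vec.++ Vec.map inj₁ u) + F (Vec.map inj₂ v Vec.++ inj₂ p ∷ Vec.map inj₁ u)

    coefficient : (F : ∀ {k} → Vec (Fin n ⊎ Fin n) k → Carrier) → (Fin m → Fin n) → ℕ → Carrier
    coefficient {m} F f r = sumOver (increasing r m) λ J → F (Vec.map (inj₂ ∘ f) J)

    -- Each split either drops an index and gains a factor t or keeps it without t. The kept indices
    -- form the subset J, the dropped ones give the power of t. Injectivity of `f` ensures that the
    -- index being split does not recur.
    splits-expand : (F : ∀ {k} → Vec (Fin n ⊎ Fin n) k → Carrier) → Splits F →
      (f : Fin m → Fin n) → (∀ {i j} → f i ≡ f j → i ≡ j) →
      F (Vec.map inj₁ (Vec.tabulate f)) ≈ evaluate (coefficient F f) t m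
    splits-expand {zero}  F split f f-inj = sym (begin
      evaluate (coefficient F f) t 0 ≈⟨ trans (∑-suc _) (+-congˡ (∑-empty _)) ⟩
      (F [] + 0#) * 1# + 0#          ≈⟨ trans (+-identityʳ _) (trans (*-identityʳ _) (+-identityʳ _)) ⟩
      F []                           ∎)
    splits-expand {suc m} F split f f-inj = begin
      F (inj₁ (f zero) ∷ Vec.map inj₁ (Vec.tabulate f₊))
        ≈⟨ split [] (f zero) _ (All.tabulate⁺ λ i f₀≡f₊ → case f-inj f₀≡f₊ of λ ()) ⟩
      t * F (Vec.map inj₁ (Vec.tabulate f₊)) + F₀ (Vec.map inj₁ (Vec.tabulate f₊))
        ≈⟨ +-cong (*-congˡ (splits-expand F split f₊ (suc-injective ∘ f-inj)))
                  (splits-expand F₀ (λ v → split (f zero ∷ v)) f₊ (suc-injective ∘ f-inj)) ⟩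
      t * evaluate (coefficient F f₊) t m + evaluate (coefficient F₀ f₊) t m
        ≈⟨ evaluate-recurrence (coefficient F f₊) (coefficient F₀ f₊) (coefficient F f) t m
             -- There are no subsets of m + 1 elements among m indices, so the coefficient one past
             -- the end is an empty sum.
             (reflexive (≡.cong (λ Js → sumOver Js λ J → F (Vec.map (inj₂ ∘ f₊) J)) (increasing-empty (ℕ.n<1+n m))))
             refl coefficient-suc ⟩
      evaluate (coefficient F f) t (suc m) ∎
      where
      f₊ : Fin m → Fin n
      f₊ = f ∘ suc
      F₀ : ∀ {k} → Vec (Fin n ⊎ Fin n) k → Carrier
      F₀ u = F (inj₂ (f zero) ∷ u)
      coefficient-suc : ∀ r → coefficient F f (suc r) ≈ coefficient F₀ f₊ r + coefficient F f₊ (suc r)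
      coefficient-suc r = begin
        coefficient F f (suc r)
          ≈⟨ sumOver-++ (List.map _ (increasing r m)) _ _ ⟩
        _ + _
          ≈⟨ +-cong (sumOver-map _ (increasing r m) _) (sumOver-map _ (increasing (suc r) m) _) ⟩
        sumOver (increasing r m) (λ J → F₀ (Vec.map (inj₂ ∘ f) (Vec.map suc J))) +
        sumOver (increasing (suc r) m) (λ J → F (Vec.map (inj₂ ∘ f) (Vec.map suc J)))
          ≈⟨ +-cong (sumOver-cong (increasing r m) λ J → reflexive (≡.cong F₀ (≡.sym (map-∘ (inj₂ ∘ f) suc J))))
                    (sumOver-cong (increasing (suc r) m) λ J → reflexive (≡.cong F (≡.sym (map-∘ (inj₂ ∘ f) suc J)))) ⟩
        coefficient F₀ f₊ r + coefficient F f₊ (suc r) ∎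

  module _ {n : ℕ} (N : Matrix n n) (t : Carrier) where

    flagged : Fin n ⊎ Fin n → Fin n ⊎ Fin n → Carrier
    flagged (inj₁ p) (inj₁ q) = t * basis q p + N p q
    flagged (inj₁ p) (inj₂ q) = N p q
    flagged (inj₂ p) (inj₁ q) = N p q
    flagged (inj₂ p) (inj₂ q) = N p q

    flagged-diagonal : ∀ p → flagged (inj₁ p) (inj₁ p) ≈ t + N p p
    flagged-diagonal p rewrite dec-true (p ≟ p) ≡.refl = +-congʳ (*-identityʳ t)

    flagged-offDiagonal : ∀ p q → p ≢ q → flagged (inj₁ p) (inj₁ q) ≈ N p q
    flagged-offDiagonal p q p≢q rewrite dec-false (p ≟ q) p≢q = trans (+-congʳ (zeroʳ t)) (+-identityˡ _)

    flagged-row : ∀ p y → y ≢ inj₁ p → flagged (inj₁ p) y ≈ flagged (inj₂ p) y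
    flagged-row p (inj₁ q) y≢p = flagged-offDiagonal p q (λ p≡q → y≢p (≡.cong inj₁ (≡.sym p≡q)))
    flagged-row p (inj₂ q) y≢p = refl

    flagged-column : ∀ p y → y ≢ inj₁ p → flagged y (inj₁ p) ≈ flagged y (inj₂ p)
    flagged-column p (inj₁ q) y≢p = flagged-offDiagonal q p (λ q≡p → y≢p (≡.cong inj₁ q≡p))
    flagged-column p (inj₂ q) y≢p = refl

    -- As `inj₁ p` does not recur in `u`, replacing it by `inj₂ p` changes the corner entry only,
    -- from t + N p p to N p p. Linearity in that entry yields t times its cofactor.
    principalDet-pivot : ∀ p {k} (u : Vec (Fin n ⊎ Fin n) k) → (∀ i → lookup u i ≢ inj₁ p) →
      principalDet flagged (inj₁ p ∷ u) ≈
      t * principalDet flagged u + principalDet flagged (inj₂ p ∷ u)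
    principalDet-pivot p {k} u u∌p = begin
      principalDet flagged (inj₁ p ∷ u)
        ≈⟨ trans (Det-expandRow _) (∑-suc _) ⟩
      1# * (flagged (inj₁ p) (inj₁ p) * principalDet flagged u) + ∑ (λ j → sign (suc j) * (flagged (inj₁ p) (lookup u j) * minor (inj₁ p) j))
        ≈⟨ +-cong (trans (*-identityˡ _) (trans (*-congʳ (flagged-diagonal p)) (distribʳ _ t _)))
             (∑-cong λ j → *-congˡ {x = sign (suc j)} (*-cong (flagged-row p (lookup u j) (u∌p j)) (minors j))) ⟩
      (t * principalDet flagged u + N p p * principalDet flagged u) + ∑ (λ j → sign (suc j) * (flagged (inj₂ p) (lookup u j) * minor (inj₂ p) j))
        ≈⟨ +-assoc _ _ _ ⟩
      t * principalDet flagged u + (N p p * principalDet flagged u + ∑ (λ j → sign (suc j) * (flagged (inj₂ p) (lookup u j) * minor (inj₂ p) j)))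
        ≈⟨ +-congˡ (trans (Det-expandRow _) (trans (∑-suc _) (+-congʳ (*-identityˡ _)))) ⟨
      t * principalDet flagged u + principalDet flagged (inj₂ p ∷ u) ∎
      where
      minor : Fin n ⊎ Fin n → Fin k → Carrier
      minor x j = Det λ r q → flagged (lookup u r) (lookup (x ∷ u) (punchIn (suc j) q))
      minors : ∀ j → minor (inj₁ p) j ≈ minor (inj₂ p) j
      -- Only column 0 of these minors depends on the first index. The split on `j` just exhibits
      -- `k` as a successor.
      minors zero    = Det-cong λ { r zero → flagged-column p (lookup u r) (u∌p r) ; r (suc q) → refl }
      minors (suc j) = Det-cong λ { r zero → flagged-column p (lookup u r) (u∌p r) ; r (suc q) → refl }

    principalDet-splits : Splits t (principalDet flagged)
    principalDet-splits v p u p∉u = begin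
      F (Vec.map inj₂ v Vec.++ inj₁ p ∷ Vec.map inj₁ u)
        ≈⟨ toFront (inj₁ p) ⟩
      F (inj₁ p ∷ w)
        ≈⟨ principalDet-pivot p w (avoids v) ⟩
      t * F w + F (inj₂ p ∷ w)
        ≈⟨ +-congˡ (toFront (inj₂ p)) ⟨
      t * F w + F (Vec.map inj₂ v Vec.++ inj₂ p ∷ Vec.map inj₁ u) ∎
      where
      F : ∀ {k} → Vec (Fin n ⊎ Fin n) k → Carrier
      F = principalDet flagged
      w = Vec.map inj₂ v Vec.++ Vec.map inj₁ u
      toFront : ∀ x → F (Vec.map inj₂ v Vec.++ x ∷ Vec.map inj₁ u) ≈ F (x ∷ w)
      toFront x = symmetric-bringToFront F (principalDet-symmetric flagged) (Vec.map inj₂ v) x _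
      avoids-u : ∀ {k} (u : Vec (Fin n) k) → All (p ≢_) u → ∀ i → lookup (Vec.map inj₁ u) i ≢ inj₁ p
      avoids-u (q ∷ u) (p≢q ∷ _)   zero    q≡p = p≢q (≡.sym (inj₁-injective q≡p))
      avoids-u (q ∷ u) (_   ∷ p∉u) (suc i) q≡p = avoids-u u p∉u i q≡p
      avoids : ∀ {m} (v : Vec (Fin n) m) i → lookup (Vec.map inj₂ v Vec.++ Vec.map inj₁ u) i ≢ inj₁ p
      avoids []      i       = avoids-u u p∉u i
      avoids (q ∷ v) (suc i) = avoids v i

    Det-scalarPlus : Det (λ p q → t * basis q p + N p q) ≈
      evaluate (λ r → sumOver (increasing r n) (principalDet N)) t n
    Det-scalarPlus = begin
      Det (λ p q → t * basis q p + N p q)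
        ≈⟨ Det-cong (λ p q → reflexive (≡.cong₂ flagged (lookup-id p) (lookup-id q))) ⟨
      principalDet flagged (Vec.map inj₁ (Vec.tabulate id))
        ≈⟨ splits-expand t (principalDet flagged) principalDet-splits id id ⟩
      evaluate (coefficient t (principalDet flagged) id) t n
        ≈⟨ ∑-cong {suc n} (λ i → *-congʳ (sumOver-cong (increasing (toℕ i) n) λ J →
             Det-cong λ p q → reflexive (≡.cong₂ flagged (lookup-map p inj₂ J) (lookup-map q inj₂ J)))) ⟩
      evaluate (λ r → sumOver (increasing r n) (principalDet N)) t n ∎
      where
      lookup-id : ∀ p → lookup (Vec.map inj₁ (Vec.tabulate id)) p ≡ inj₁ p
      lookup-id p = ≡.trans (lookup-map p inj₁ (Vec.tabulate id)) (≡.cong inj₁ (lookup∘tabulate id p))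

  -- The matrix of η as a sum of two rank one matrices

  -- Distinctness matters: for x = y the nested tests of `differenceRow` return 1 at x, whereas the
  -- difference is 0.
  differenceRow-basis : {x y : Fin n} → x ≢ y → ∀ p → differenceRow x y p ≈ basis x p - basis y p
  differenceRow-basis {x = x} {y} x≢y p with p ≟ x
  ... | yes ≡.refl rewrite dec-false (p ≟ y) x≢y = sym (trans (+-congˡ -0#≈0#) (+-identityʳ 1#))
  ... | no  _ with p ≟ y
  ...   | yes _ = sym (+-identityˡ _)
  ...   | no  _ = sym (-‿inverseʳ 0#)

  differenceRow-first : (x y : Fin n) → differenceRow x y x ≈ 1#
  differenceRow-first x y rewrite dec-true (x ≟ x) ≡.refl = refl

  differenceRow-second : {x y : Fin n} → y ≢ x → differenceRow x y y ≈ - 1#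
  differenceRow-second {x = x} {y} y≢x rewrite dec-false (y ≟ x) y≢x | dec-true (y ≟ y) ≡.refl = refl

  differenceRow-other : {x y p : Fin n} → p ≢ x → p ≢ y → differenceRow x y p ≈ 0#
  differenceRow-other {x = x} {y} {p} p≢x p≢y rewrite dec-false (p ≟ x) p≢x | dec-false (p ≟ y) p≢y = refl

  ∑-basis : (x : Fin n) → ∑ (basis x) ≈ 1#
  ∑-basis zero    = trans (∑-suc _) (trans (+-congˡ (∑-zero λ _ → refl)) (+-identityʳ 1#))
  ∑-basis (suc x) = trans (∑-suc _) (trans (+-identityˡ _) (∑-basis x))

  ∑-differenceRow : {x y : Fin n} → x ≢ y → ∑ (differenceRow x y) ≈ 0#
  ∑-differenceRow {x = x} {y} x≢y = begin
    ∑ (differenceRow x y)             ≈⟨ ∑-cong (differenceRow-basis x≢y) ⟩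
    ∑ (λ p → basis x p - basis y p)   ≈⟨ ∑-+ _ _ ⟩
    ∑ (basis x) + ∑ (λ p → - basis y p)  ≈⟨ +-cong (∑-basis x) (trans (∑-neg _) (-‿cong (∑-basis y))) ⟩
    1# - 1#                           ≈⟨ -‿inverseʳ 1# ⟩
    0#                                ∎

  -- This is b aᵀ + a bᵀ; the order of the summands is that of `bothSides`, with `outside` first.
  symmetrized : Quad n → Fin n → Fin n → Carrier
  symmetrized e p q = rowB e p * rowA e q + rowA e p * rowB e q

  module _ {i j k l : Fin n} (p q : Fin n) where

    private
      δ : Fin n → Carrier
      δ x = basis q x

    η-preimages : ∀ {u v w x} → preimage i j k l p ≡ u → preimage i l k j p ≡ v →
      preimage i j l k p ≡ w → preimage i k l j p ≡ x →
      extendLinearly (λ σ → basis q (σ ⟨$⟩ˡ p)) (η (i ∷ j ∷ k ∷ l ∷ [])) ≈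
      (δ u + δ v) + (- δ w + - δ x)
    η-preimages {u} {v} {w} {x} ≡.refl ≡.refl ≡.refl ≡.refl = begin
      1# * δ u + (1# * δ v + (- 1# * δ w + (- 1# * δ x + 0#)))
        ≈⟨ +-cong (*-identityˡ _) (+-cong (*-identityˡ _) (+-cong (-1*x≈-x _) (trans (+-identityʳ _) (-1*x≈-x _)))) ⟩
      δ u + (δ v + (- δ w + - δ x)) ≈⟨ +-assoc _ _ _ ⟨
      (δ u + δ v) + (- δ w + - δ x) ∎

    symmetrized-rows : ∀ {α β} → i ≢ j → k ≢ l → rowA (i ∷ j ∷ k ∷ l ∷ []) p ≈ α → rowB (i ∷ j ∷ k ∷ l ∷ []) p ≈ β →
      symmetrized (i ∷ j ∷ k ∷ l ∷ []) p q ≈ β * (basis i q - basis j q) + α * (basis k q - basis l q)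
    symmetrized-rows i≢j k≢l A≈α B≈β =
      +-cong (*-cong B≈β (differenceRow-basis i≢j q)) (*-cong A≈α (differenceRow-basis k≢l q))

  basis-sym : (x y : Fin n) → basis x y ≈ basis y x
  basis-sym x y with x ≟ y
  ... | yes ≡.refl rewrite dec-true (x ≟ x) ≡.refl = refl
  ... | no  x≢y    rewrite dec-false (y ≟ x) (x≢y ∘ ≡.sym) = refl

  -- Compared row by row. For p among the four entries, one point occurs as a preimage under two of
  -- the cycles with opposite signs, and the other two preimages leave a difference of basis values.
  -- Any other p is fixed by all four cycles, whose coefficients add up to 0.
  η-entry : (e : Quad n) → Unique e → ∀ p q →
            extendLinearly (λ σ → basis q (σ ⟨$⟩ˡ p)) (η e) ≈ - symmetrized e p q
  η-entry {n} e@(i ∷ j ∷ k ∷ l ∷ []) ((i≢j ∷ i≢k ∷ i≢l ∷ []) ∷ (j≢k ∷ j≢l ∷ []) ∷ (k≢l ∷ []) ∷ [] ∷ []) p q =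
    byCases (p ≟ i) (p ≟ j) (p ≟ k) (p ≟ l)
    where
    δ : Fin n → Carrier
    δ x = basis q x

    j≢i = i≢j ∘ ≡.sym
    k≢i = i≢k ∘ ≡.sym
    l≢i = i≢l ∘ ≡.sym
    k≢j = j≢k ∘ ≡.sym
    l≢j = j≢l ∘ ≡.sym
    l≢k = k≢l ∘ ≡.sym

    rows : ∀ {α β} → rowA e p ≈ α → rowB e p ≈ β →
           - symmetrized e p q ≈ β * (δ j - δ i) + α * (δ l - δ k)
    rows {α} {β} A≈α B≈β = begin
      - symmetrized e p q
        ≈⟨ -‿cong (symmetrized-rows p q i≢j k≢l A≈α B≈β) ⟩
      - (β * (basis i q - basis j q) + α * (basis k q - basis l q))
        ≈⟨ -‿+-comm _ _ ⟨
      - (β * (basis i q - basis j q)) + - (α * (basis k q - basis l q))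
        ≈⟨ +-cong (turn β i j) (turn α k l) ⟩
      β * (δ j - δ i) + α * (δ l - δ k) ∎
      where
      -- The minus sign is spent on reversing the difference; `basis-sym` is needed because
      -- permutations evaluate `basis q` at a preimage, while the rows evaluate `basis x` at q.
      turn : ∀ γ x y → - (γ * (basis x q - basis y q)) ≈ γ * (δ y - δ x)
      turn γ x y = trans (-‿distribʳ-* _ _) (*-congˡ (trans (⁻¹-anti-homo‿- _ _)
        (+-cong (basis-sym y q) (-‿cong (basis-sym x q)))))

    onlyˡ : ∀ β s t → β * s + 0# * t ≈ β * s
    onlyˡ β s t = trans (+-congˡ (zeroˡ t)) (+-identityʳ _)
    onlyʳ : ∀ α s t → 0# * s + α * t ≈ α * t
    onlyʳ α s t = trans (+-congʳ (zeroˡ s)) (+-identityˡ _)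
    negated : ∀ x y → - 1# * (x - y) ≈ y - x
    negated x y = trans (-1*x≈-x _) (⁻¹-anti-homo‿- x y)
    cancel : ∀ x s → (x - x) + s ≈ s
    cancel x s = trans (+-congʳ (-‿inverseʳ x)) (+-identityˡ s)

    byCases : Dec (p ≡ i) → Dec (p ≡ j) → Dec (p ≡ k) → Dec (p ≡ l) →
              extendLinearly (λ σ → basis q (σ ⟨$⟩ˡ p)) (η e) ≈ - symmetrized e p q
    byCases (yes ≡.refl) _ _ _ = begin
      _ ≈⟨ η-preimages p q (preimage-first i j k l l≢i l≢j l≢k) (preimage-first i l k j j≢i j≢l j≢k)
                           (preimage-first i j l k k≢i k≢j k≢l) (preimage-first i k l j j≢i j≢k j≢l) ⟩
      (δ l + δ j) + (- δ k + - δ j)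
        ≈⟨ solve 4 (λ x y z w → (x :+ y) :+ (z :+ w) := (y :+ w) :+ (x :+ z)) refl _ _ _ _ ⟩
      (δ j - δ j) + (δ l - δ k)           ≈⟨ cancel _ _ ⟩
      δ l - δ k                           ≈⟨ trans (onlyʳ 1# _ _) (*-identityˡ _) ⟨
      0# * (δ j - δ i) + 1# * (δ l - δ k) ≈⟨ rows (differenceRow-first i j) (differenceRow-other i≢k i≢l) ⟨
      - symmetrized e p q ∎
    byCases (no _) (yes ≡.refl) _ _ = begin
      _ ≈⟨ η-preimages p q (preimage-second i j k l j≢i j≢k j≢l) (preimage-fourth i l k j k≢i k≢l)
                           (preimage-second i j l k j≢i j≢l j≢k) (preimage-fourth i k l j l≢i l≢k) ⟩
      (δ i + δ k) + (- δ i + - δ l)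
        ≈⟨ solve 4 (λ x y z w → (x :+ y) :+ (z :+ w) := (x :+ z) :+ (y :+ w)) refl _ _ _ _ ⟩
      (δ i - δ i) + (δ k - δ l)             ≈⟨ cancel _ _ ⟩
      δ k - δ l                             ≈⟨ trans (onlyʳ (- 1#) _ _) (negated _ _) ⟨
      0# * (δ j - δ i) + - 1# * (δ l - δ k) ≈⟨ rows (differenceRow-second j≢i) (differenceRow-other j≢k j≢l) ⟨
      - symmetrized e p q ∎
    byCases (no _) (no _) (yes ≡.refl) _ = begin
      _ ≈⟨ η-preimages p q (preimage-third i j k l k≢i k≢l) (preimage-third i l k j k≢i k≢j)
                           (preimage-fourth i j l k l≢i l≢j) (preimage-second i k l j k≢i k≢l k≢j) ⟩
      (δ j + δ l) + (- δ l + - δ i)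
        ≈⟨ solve 4 (λ x y z w → (x :+ y) :+ (z :+ w) := (y :+ z) :+ (x :+ w)) refl _ _ _ _ ⟩
      (δ l - δ l) + (δ j - δ i)           ≈⟨ cancel _ _ ⟩
      δ j - δ i                           ≈⟨ trans (onlyˡ 1# _ _) (*-identityˡ _) ⟨
      1# * (δ j - δ i) + 0# * (δ l - δ k) ≈⟨ rows (differenceRow-other k≢i k≢j) (differenceRow-first k l) ⟨
      - symmetrized e p q ∎
    byCases (no _) (no _) (no _) (yes ≡.refl) = begin
      _ ≈⟨ η-preimages p q (preimage-fourth i j k l k≢i k≢j) (preimage-second i l k j l≢i l≢k l≢j)
                           (preimage-third i j l k l≢i l≢k) (preimage-third i k l j l≢i l≢j) ⟩
      (δ k + δ i) + (- δ j + - δ k)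
        ≈⟨ solve 4 (λ x y z w → (x :+ y) :+ (z :+ w) := (x :+ w) :+ (y :+ z)) refl _ _ _ _ ⟩
      (δ k - δ k) + (δ i - δ j)             ≈⟨ cancel _ _ ⟩
      δ i - δ j                             ≈⟨ trans (onlyˡ (- 1#) _ _) (negated _ _) ⟨
      - 1# * (δ j - δ i) + 0# * (δ l - δ k) ≈⟨ rows (differenceRow-other l≢i l≢j) (differenceRow-second l≢k) ⟨
      - symmetrized e p q ∎
    byCases (no p≢i) (no p≢j) (no p≢k) (no p≢l) = begin
      _ ≈⟨ η-preimages p q (preimage-other i j k l p≢i p≢j p≢k p≢l) (preimage-other i l k j p≢i p≢l p≢k p≢j)
                           (preimage-other i j l k p≢i p≢j p≢l p≢k) (preimage-other i k l j p≢i p≢k p≢l p≢j) ⟩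
      (δ p + δ p) + (- δ p + - δ p)
        ≈⟨ solve 4 (λ x y z w → (x :+ y) :+ (z :+ w) := (x :+ z) :+ (y :+ w)) refl _ _ _ _ ⟩
      (δ p - δ p) + (δ p - δ p)           ≈⟨ trans (cancel _ _) (-‿inverseʳ _) ⟩
      0#                                  ≈⟨ trans (onlyʳ 0# _ _) (zeroˡ _) ⟨
      0# * (δ j - δ i) + 0# * (δ l - δ k) ≈⟨ rows (differenceRow-other p≢i p≢j) (differenceRow-other p≢k p≢l) ⟨
      - symmetrized e p q ∎

  -- The matrix N of -z, its principal minors and Φ

  Generic : Lin (Quad n) → Set _
  Generic = ListAll.All (Unique ∘ proj₂)

  extend-congGeneric : {x : Lin (Quad n)} → Generic x → {f g : Quad n → Carrier} →
    (∀ e → Unique e → f e ≈ g e) → extendLinearly f x ≈ extendLinearly g x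
  extend-congGeneric []          f≈g = refl
  extend-congGeneric (e! ∷ generic) f≈g = +-cong (*-congˡ (f≈g _ e!)) (extend-congGeneric generic f≈g)

  extend-⟦⟧ : (x : Lin (Quad n)) (f : _ → Carrier) →
    extendLinearly f ⟦ x ⟧ ≈ extendLinearly (λ e → extendLinearly f (η e)) x
  extend-⟦⟧ []            f = refl
  extend-⟦⟧ ((a , e) ∷ x) f = begin
    extendLinearly f (scale a (η e) ++ ⟦ x ⟧)           ≈⟨ sumOver-++ (scale a (η e)) ⟦ x ⟧ _ ⟩
    extendLinearly f (scale a (η e)) + extendLinearly f ⟦ x ⟧
      ≈⟨ +-cong (trans (sumOver-map _ (η e) _) (trans (sumOver-cong (η e) λ _ → *-assoc _ _ _) (sym (sumOver-*ˡ (η e) a _)))) (extend-⟦⟧ x f) ⟩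
    _ ∎

  z-generic : (w : Fin n → Fin n → Fin n → Fin n → Carrier) → Generic (z w)
  z-generic {n} w = ListAll.concat⁺ (ListAll.map⁺ (ListAll.map ξ-generic (increasing-unique 4 n)))
    where
    ξ-generic : ∀ {e} → Unique e → Generic (ξ w e)
    ξ-generic {i ∷ j ∷ k ∷ l ∷ []} e!@((i≢j ∷ i≢k ∷ i≢l ∷ []) ∷ (j≢k ∷ j≢l ∷ []) ∷ (k≢l ∷ []) ∷ [] ∷ []) =
      e! ∷ ((i≢k ∷ i≢l ∷ i≢j ∷ []) ∷ (k≢l ∷ (j≢k ∘ ≡.sym) ∷ []) ∷ ((j≢l ∘ ≡.sym) ∷ []) ∷ [] ∷ []) ∷ []

  -- Chosen to agree with `shuffle`: where I is `inside`, the row of A goes to the left and that of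
  -- B to the right, as the shuffles by I and by `∁ I` prescribe.
  left right : Quad n × Bool → Fin n → Carrier
  left  (e , b) = if b then rowA e else rowB e
  right (e , b) = if b then rowB e else rowA e

  -- The matrix N, written with a single product per summand, the form that `Det-CauchyBinet` takes.
  negMatrix : Lin (Quad n) → Matrix n n
  negMatrix x p q = extendLinearly (λ e → left e p * right e q) (bothSides x)

  negMatrix-symmetrized : (x : Lin (Quad n)) → ∀ p q →
    negMatrix x p q ≈ extendLinearly (λ e → symmetrized e p q) x
  negMatrix-symmetrized x p q = extend-bothSides x _

  act-negMatrix : {x : Lin (Quad n)} → Generic x → ∀ p q → - act ⟦ x ⟧ (basis q) p ≈ negMatrix x p q
  act-negMatrix {x = x} generic p q = begin
    - act ⟦ x ⟧ (basis q) p
      ≈⟨ -1*x≈-x _ ⟨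
    - 1# * act ⟦ x ⟧ (basis q) p
      ≈⟨ trans (*-congˡ (extend-⟦⟧ x _)) (extend-*ˡ x _ _) ⟩
    extendLinearly (λ e → - 1# * extendLinearly (λ σ → basis q (σ ⟨$⟩ˡ p)) (η e)) x
      ≈⟨ extend-congGeneric generic (λ e e! → trans (-1*x≈-x _) (trans (-‿cong (η-entry e e! p q)) (-‿involutive _))) ⟩
    extendLinearly (λ e → symmetrized e p q) x
      ≈⟨ negMatrix-symmetrized x p q ⟨
    negMatrix x p q ∎

  -- The coordinates of a and of b each sum to zero, so the row vector of ones annihilates both a bᵀ
  -- and b aᵀ from the left.
  negMatrix-columnSums : {x : Lin (Quad n)} → Generic x → ∀ q → ∑ (λ p → negMatrix x p q) ≈ 0#
  negMatrix-columnSums {x = x} generic q = begin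
    ∑ (λ p → negMatrix x p q)
      ≈⟨ ∑-cong (λ p → negMatrix-symmetrized x p q) ⟩
    ∑ (λ p → extendLinearly (λ e → symmetrized e p q) x)
      ≈⟨ extend-∑ x _ ⟨
    extendLinearly (λ e → ∑ λ p → symmetrized e p q) x
      ≈⟨ extend-congGeneric generic (λ e e! → trans (vanishes e e!) (sym (zeroˡ 0#))) ⟩
    extendLinearly (λ e → 0# * 0#) x
      ≈⟨ extend-*ˡ x _ _ ⟨
    0# * extendLinearly (λ e → 0#) x
      ≈⟨ zeroˡ _ ⟩
    0# ∎
    where
    vanishes : ∀ e → Unique e → ∑ (λ p → symmetrized e p q) ≈ 0#
    vanishes e@(i ∷ j ∷ k ∷ l ∷ []) ((i≢j ∷ _) ∷ _ ∷ (k≢l ∷ []) ∷ _) = begin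
      ∑ (λ p → rowB e p * rowA e q + rowA e p * rowB e q)
        ≈⟨ trans (∑-+ _ _) (+-cong (trans (∑-cong λ p → *-comm _ _) (sym (∑-*ˡ _ _))) (trans (∑-cong λ p → *-comm _ _) (sym (∑-*ˡ _ _)))) ⟩
      rowA e q * ∑ (rowB e) + rowB e q * ∑ (rowA e)
        ≈⟨ +-cong (trans (*-congˡ (∑-differenceRow k≢l)) (zeroʳ _)) (trans (*-congˡ (∑-differenceRow i≢j)) (zeroʳ _)) ⟩
      0# + 0#
        ≈⟨ +-identityˡ 0# ⟩
      0# ∎

  principalMinors : Matrix n n → ℕ → Carrier
  principalMinors {n} N r = sumOver (increasing r n) (principalDet N)

  principalMinors-full : (N : Matrix n n) → principalMinors N n ≈ Det N
  principalMinors-full {n} N = begin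
    sumOver (increasing n n) (principalDet N)  ≈⟨ reflexive (≡.cong (λ Js → sumOver Js (principalDet N)) (increasing-full n)) ⟩
    principalDet N (Vec.tabulate id) + 0#      ≈⟨ +-identityʳ _ ⟩
    principalDet N (Vec.tabulate id)           ≈⟨ Det-cong (λ p q → reflexive (≡.cong₂ N (lookup∘tabulate id p) (lookup∘tabulate id q))) ⟩
    Det N                                      ∎

  sdet-rowsDet : (E : Vec (Quad n) r) (J : Vec (Fin n) r) →
    sdet (columns A[ E ] J) (columns B[ E ] J) ≈
    sumOver (subsets r) λ I → rowsDet (λ e p → left e (lookup J p)) (Vec.zip E I) *
                              rowsDet (λ e p → right e (lookup J p)) (Vec.zip E I)
  sdet-rowsDet {r = r} E J = sumOver-cong (subsets r) λ I → *-cong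
    (trans (sym (Det≈det _)) (Det-cong (λ s p → shuffle-left (lookup E s) (lookup I s) p (lookup-zip s E I))))
    (trans (sym (Det≈det _)) (Det-cong (λ s p → shuffle-right s p (lookup-map s not I) (lookup-zip s E I))))
    where
    shuffle-left : ∀ e b p {d} → d ≡ (e , b) →
      (if b then (λ q → rowA e (lookup J q)) else (λ q → rowB e (lookup J q))) p ≈ left d (lookup J p)
    shuffle-left e true  p ≡.refl = refl
    shuffle-left e false p ≡.refl = refl
    shuffle-right : ∀ s p {b c d} → c ≡ not b → d ≡ (lookup E s , b) →
      (if c then columns A[ E ] J s else columns B[ E ] J s) p ≈ right d (lookup J p)
    shuffle-right s p {true}  ≡.refl ≡.refl = refl
    shuffle-right s p {false} ≡.refl ≡.refl = refl

  principalMinors-Φ : (x : Lin (Quad n)) (r : ℕ) → (r !) · principalMinors (negMatrix x) r ≈ Φ (x ⊗^ r)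
  principalMinors-Φ {n} x r = begin
    (r !) · sumOver (increasing r n) (principalDet (negMatrix x))
      ≈⟨ sumOver-· (r !) (increasing r n) _ ⟨
    sumOver (increasing r n) (λ J → (r !) · principalDet (negMatrix x) J)
      -- Restricting N to the rows and columns in J restricts both vectors of every rank one summand
      -- to J, so Cauchy-Binet applies to each principal minor separately.
      ≈⟨ sumOver-cong (increasing r n) (λ J → trans (Det-CauchyBinet (bothSides x) (λ e p → left e (lookup J p)) (λ e p → right e (lookup J p)))
           (extend-bothSides-⊗ r x _)) ⟩
    sumOver (increasing r n) (λ J → extendLinearly (λ E → sumOver (subsets r) λ I → _) (x ⊗^ r))
      ≈⟨ extend-sumOver (x ⊗^ r) (increasing r n) _ ⟨
    extendLinearly (λ E → sumOver (increasing r n) λ J → sumOver (subsets r) λ I → _) (x ⊗^ r)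
      ≈⟨ extend-cong (x ⊗^ r) (λ E → sumOver-cong (increasing r n) λ J → sdet-rowsDet E J) ⟨
    Φ (x ⊗^ r) ∎

  χ-principalMinors : {x : Lin (Quad n)} → Generic x → ∀ t →
    χ ⟦ x ⟧ t ≈ evaluate (principalMinors (negMatrix x)) t n
  χ-principalMinors {x = x} generic t = begin
    χ ⟦ x ⟧ t                                          ≈⟨ Det≈det _ ⟨
    Det (λ p q → t * basis q p - act ⟦ x ⟧ (basis q) p)  ≈⟨ Det-cong (λ p q → +-congˡ (act-negMatrix generic p q)) ⟩
    Det (λ p q → t * basis q p + negMatrix x p q)       ≈⟨ Det-scalarPlus (negMatrix x) t ⟩
    evaluate (principalMinors (negMatrix x)) t _        ∎

  -- For n = 0 the leading coefficient 1 is also the constant one, so its vanishing can be asked for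
  -- only when n is a successor.
  evaluate-monic : ∀ (a : ℕ → Carrier) t n → a 0 ≈ 1# → (∀ m → n ≡ suc m → a (suc m) ≈ 0#) →
    evaluate a t n ≈ t ^ n + sum {n ∸ 1} λ i → a (suc (toℕ i)) * t ^ (n ∸ suc (toℕ i))
  evaluate-monic a t zero    a₀ aₙ = trans (∑-suc _) (+-cong (trans (*-congʳ a₀) (*-identityˡ 1#)) (∑-empty _))
  evaluate-monic a t (suc m) a₀ aₙ = begin
    evaluate a t (suc m)
      ≈⟨ trans (∑-suc {suc m} _) (+-cong (trans (*-congʳ a₀) (*-identityˡ _)) (∑≈sum {suc m} term)) ⟩
    t ^ suc m + sum term
      ≈⟨ +-congˡ (trans (sum-init-last term) (+-congˡ last≈0)) ⟩
    t ^ suc m + (sum (λ i → term (inject₁ i)) + 0#)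
      ≈⟨ +-congˡ (trans (+-identityʳ _) (sum-cong-≋ {m} {term ∘ inject₁} λ i → reflexive (≡.cong (λ k → a (suc k) * t ^ (m ∸ k)) (toℕ-inject₁ i)))) ⟩
    t ^ suc m + sum {m} (λ i → a (suc (toℕ i)) * t ^ (m ∸ toℕ i)) ∎
    where
    term : Fin (suc m) → Carrier
    term i = a (suc (toℕ i)) * t ^ (m ∸ toℕ i)
    last≈0 : term (fromℕ m) ≈ 0#
    last≈0 = trans (*-congʳ (trans (reflexive (≡.cong (a ∘ suc) (toℕ-fromℕ m))) (aₙ m ≡.refl))) (zeroˡ _)

theorem8 : ∀ {c ℓ₁ ℓ₂} (F : HeytingField c ℓ₁ ℓ₂) → CharacteristicZero F →
    let open LieElement (fieldRing F) in
    (n : ℕ) (w : Fin n → Fin n → Fin n → Fin n → Carrier) →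
    Σ[ μ ∈ (ℕ → Carrier) ] ( ((t : Carrier) →
    χ ⟦ z w ⟧ t ≈ t ^ n + sum {n ∸ 1} (λ i → μ (suc (toℕ i)) * t ^ (n ∸ suc (toℕ i))))
    × ((r : ℕ) → 1 ≤ r → r < n → (r !) · μ r ≈ Φ (z w ⊗^ r)) )
theorem8 F _ n w =
  μ , (λ t → trans (χ-principalMinors generic t) (evaluate-monic μ t n μ₀ (μₙ n w)))
    , (λ r _ _ → principalMinors-Φ (z w) r)
  where
  open LieElement (fieldRing F)
  open CommutativeRing (fieldRing F) using (trans; +-identityʳ)
  open Development (fieldRing F)
  generic = z-generic w
  μ : ℕ → Carrier
  μ = principalMinors (negMatrix (z w))
  μ₀ : μ 0 ≈ 1#
  μ₀ = trans (+-identityʳ _) (Det-empty _)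
  -- Quantified over `n` and `w` anew, so that the equation between `n` and `suc m` can be matched.
  μₙ : ∀ n (w : Fin n → Fin n → Fin n → Fin n → Carrier) m → n ≡ suc m → principalMinors (negMatrix (z w)) (suc m) ≈ 0#
  μₙ _ w m ≡.refl = trans (principalMinors-full (negMatrix (z w))) (Det-zeroColumnSums _ (negMatrix-columnSums (z-generic w)))
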